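{- Let $\mathcal T$ be a simple quadrilateral tiling of a closed, connected, orientable surface of positive genus, let $R$ be a ring, and let $n\ge|B(\mathcal T)|-1$, where $B(\mathcal T)$ is the set of black vertices of $\mathcal T$. Then the incidence theorem in $\mathbb P^n(R)$ associated with $\mathcal T$ holds if and only if the group of units $R^\times$ is commutative.
   Context: A polygonal subdivision of a closed surface is a cellular decomposition in which the closure of every $2$-cell is an embedded polygon with at least two vertices. A quadrilateral tiling is a polygonal subdivision in which all faces (tiles) are quadrilaterals and vertices are colored black and white so that every edge joins vertices of different colors; it is simple if no two edges join the same pair of vertices. For a left $R$-module $M$: a point of $\mathbb P(M)$ is a free rank-one submodule $A\subset M$ that is a direct summand of $M$; a hyperplane is a submodule $\ell\subset M$ with $M=A\oplus\ell$ for some point $A$; a point $A$ and hyperplane $\ell$ are non-neighboring if $M=A\oplus\ell$. $\mathbb P^n(R)=\mathbb P(R^{n+1})$ with $R^{n+1}$ the free left module. A realization of $\mathcal T$ in $\mathbb P^n(R)$ assigns a point to each black vertex and a hyperplane to each white vertex so that for every edge the point and hyperplane at its endpoints are non-neighboring. A tile with black-vertex points $A_1,A_2$ and white-vertex hyperplanes $\ell_1,\ell_2$ is coherent if $(A_1+A_2)\cap\ell_1=(A_1+A_2)\cap\ell_2$. The incidence theorem associated with $\mathcal T$ in $\mathbb P^n(R)$ is: for every realization of $\mathcal T$ in $\mathbb P^n(R)$, if all tiles except one are coherent, then the remaining tile is coherent. -}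

module Defs where

open import Level using (Level; _⊔_) renaming (suc to lsuc)
open import Data.Nat using (ℕ; zero; suc; _≤_; _∸_)
import Data.Nat as ℕ
open import Data.Fin using (Fin)
open import Data.Sum using (_⊎_; inj₁; inj₂)
open import Data.Product using (Σ; ∃; ∃₂; _×_; _,_; ∃-syntax)
open import Data.Unit.Polymorphic using (⊤)
open import Data.Empty using (⊥)
open import Relation.Binary.PropositionalEquality using (_≡_; _≢_)
open import Algebra.Bundles using (Ring)
open import Function.Bundles using (_⇔_)

-- Combinatorial part: quadrilateral tilings of closed connected
-- orientable surfaces, encoded as combinatorial maps (rotation systems).
-- Darts = half-edges; α = edge involution; σ = rotation around vertices;
-- faces = orbits of φ = σ ∘ α.  (Heffter–Edmonds: such data are exactly
-- cellular embeddings of connected graphs in closed orientable surfaces.)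

iter : ∀ {a} {A : Set a} → (A → A) → ℕ → A → A
iter f zero    x = x
iter f (suc k) x = f (iter f k x)

SameOrbit : ∀ {m} → (Fin m → Fin m) → Fin m → Fin m → Set
SameOrbit f x y = ∃[ k ] iter f k x ≡ y

data Reach {m} (σ α : Fin m → Fin m) (x : Fin m) : Fin m → Set where
  here : Reach σ α x x
  viaσ : ∀ {y} → Reach σ α x y → Reach σ α x (σ y)
  viaα : ∀ {y} → Reach σ α x y → Reach σ α x (α y)

Bip : ∀ {b w} → Fin b ⊎ Fin w → Fin b ⊎ Fin w → Set
Bip (inj₁ _) (inj₂ _) = Data.Unit.⊤
  where import Data.Unit
Bip (inj₂ _) (inj₁ _) = Data.Unit.⊤
  where import Data.Unit
Bip (inj₁ _) (inj₁ _) = ⊥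
Bip (inj₂ _) (inj₂ _) = ⊥

record QuadTiling : Set where
  field
    nDart nEdge nBlack nWhite nFace : ℕ
    α σ σ⁻¹ : Fin nDart → Fin nDart
    σ-σ⁻¹ : ∀ x → σ (σ⁻¹ x) ≡ x
    σ⁻¹-σ : ∀ x → σ⁻¹ (σ x) ≡ x
    α-invol : ∀ x → α (α x) ≡ x
    α-free : ∀ x → α x ≢ x
    vertex : Fin nDart → Fin nBlack ⊎ Fin nWhite
    vertex-surj : ∀ v → ∃[ x ] vertex x ≡ v
    vertex-orbit : ∀ x y → (vertex x ≡ vertex y) ⇔ SameOrbit σ x y
    edge : Fin nDart → Fin nEdge
    edge-surj : ∀ e → ∃[ x ] edge x ≡ e
    edge-orbit : ∀ x y → (edge x ≡ edge y) ⇔ (y ≡ x ⊎ y ≡ α x)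
    face : Fin nDart → Fin nFace
    face-surj : ∀ f → ∃[ x ] face x ≡ f
    face-orbit : ∀ x y → (face x ≡ face y) ⇔ SameOrbit (λ z → σ (α z)) x y
    bipartite : ∀ x → Bip (vertex x) (vertex (α x))
    -- every face is a quadrilateral whose closure is embedded
    -- (its four boundary vertices are pairwise distinct)
    quadrilateral : ∀ x → iter (λ z → σ (α z)) 4 x ≡ x
    embedded : ∀ x → vertex x ≢ vertex (iter (λ z → σ (α z)) 2 x)
    simple : ∀ x y → vertex x ≡ vertex y → vertex (α x) ≡ vertex (α y) → x ≡ y
    dart₀ : Fin nDart
    connected : ∀ x y → Reach σ α x y
    genus : ℕ
    genus-pos : 1 ≤ genus
    euler : nBlack ℕ.+ nWhite ℕ.+ nFace ℕ.+ 2 ℕ.* genus ≡ 2 ℕ.+ nEdge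

-- Algebraic part: points and hyperplanes of P^n(R) = P(R^{n+1}),
-- R^{n+1} the free left R-module (Fin (suc n) → Carrier).

module _ {c ℓ} (R : Ring c ℓ) (n : ℕ) where
  open Ring R

  M : Set c
  M = Fin (suc n) → Carrier

  _≈ᴹ_ : M → M → Set ℓ
  u ≈ᴹ v = ∀ i → u i ≈ v i

  _+ᴹ_ : M → M → M
  (u +ᴹ v) i = u i + v i

  _·ᴹ_ : Carrier → M → M
  (r ·ᴹ v) i = r * v i

  0ᴹ : M
  0ᴹ i = 0#

  record Submodule : Set (lsuc (c ⊔ ℓ)) where
    field
      mem : M → Set (c ⊔ ℓ)
      mem-resp : ∀ {u v} → u ≈ᴹ v → mem u → mem v
      mem-0 : mem 0ᴹ
      mem-+ : ∀ {u v} → mem u → mem v → mem (u +ᴹ v)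
      mem-· : ∀ r {u} → mem u → mem (r ·ᴹ u)
  open Submodule public

  DirectSum : Submodule → Submodule → Set (c ⊔ ℓ)
  DirectSum A L =
    (∀ v → ∃₂ λ a b → mem A a × mem L b × v ≈ᴹ (a +ᴹ b)) ×
    (∀ v → mem A v → mem L v → v ≈ᴹ 0ᴹ)

  FreeRankOne : Submodule → Set (c ⊔ ℓ)
  FreeRankOne A = ∃ λ a →
    (∀ v → mem A v ⇔ (∃ λ r → v ≈ᴹ (r ·ᴹ a))) ×
    (∀ r → (r ·ᴹ a) ≈ᴹ 0ᴹ → r ≈ 0#)

  IsPoint : Submodule → Set (lsuc (c ⊔ ℓ))
  IsPoint A = FreeRankOne A × ∃ λ L → DirectSum A L

  IsHyperplane : Submodule → Set (lsuc (c ⊔ ℓ))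
  IsHyperplane L = ∃ λ A → IsPoint A × DirectSum A L

  NonNeighboring : Submodule → Submodule → Set (c ⊔ ℓ)
  NonNeighboring A L = DirectSum A L

  InSum : Submodule → Submodule → M → Set (c ⊔ ℓ)
  InSum A₁ A₂ v = ∃₂ λ a b → mem A₁ a × mem A₂ b × v ≈ᴹ (a +ᴹ b)

  Coherent : Submodule → Submodule → Submodule → Submodule → Set (c ⊔ ℓ)
  Coherent A₁ A₂ L₁ L₂ =
    ∀ v → (InSum A₁ A₂ v × mem L₁ v) ⇔ (InSum A₁ A₂ v × mem L₂ v)

  module _ {nB nW : ℕ} (pt : Fin nB → Submodule) (hp : Fin nW → Submodule) where
    EdgeCond : Fin nB ⊎ Fin nW → Fin nB ⊎ Fin nW → Set (c ⊔ ℓ)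
    EdgeCond (inj₁ b) (inj₂ w) = NonNeighboring (pt b) (hp w)
    EdgeCond (inj₂ w) (inj₁ b) = NonNeighboring (pt b) (hp w)
    EdgeCond _ _ = ⊤   -- impossible by bipartiteness

    TileCond : (v₀ v₁ v₂ v₃ : Fin nB ⊎ Fin nW) → Set (c ⊔ ℓ)
    TileCond (inj₁ a₁) (inj₂ l₁) (inj₁ a₂) (inj₂ l₂) = Coherent (pt a₁) (pt a₂) (hp l₁) (hp l₂)
    TileCond (inj₂ l₁) (inj₁ a₁) (inj₂ l₂) (inj₁ a₂) = Coherent (pt a₁) (pt a₂) (hp l₁) (hp l₂)
    TileCond _ _ _ _ = ⊤   -- impossible by bipartiteness

  module _ (T : QuadTiling) where
    open QuadTiling T

    record Realization : Set (lsuc (c ⊔ ℓ)) where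
      field
        pt : Fin nBlack → Submodule
        hp : Fin nWhite → Submodule
        pt-point : ∀ b → IsPoint (pt b)
        hp-hyperplane : ∀ w → IsHyperplane (hp w)
        edges-ok : ∀ x → EdgeCond pt hp (vertex x) (vertex (α x))

    TileCoherent : Realization → Fin nFace → Set (c ⊔ ℓ)
    TileCoherent ρ f = ∀ x → face x ≡ f →
      TileCond (Realization.pt ρ) (Realization.hp ρ)
        (vertex x) (vertex (φ x)) (vertex (φ (φ x))) (vertex (φ (φ (φ x))))
      where
        φ : Fin nDart → Fin nDart
        φ z = σ (α z)

    IncidenceTheorem : Set (lsuc (c ⊔ ℓ))
    IncidenceTheorem = ∀ (ρ : Realization) (f₀ : Fin nFace) →
      (∀ f → f ≢ f₀ → TileCoherent ρ f) → TileCoherent ρ f₀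

module _ {c ℓ} (R : Ring c ℓ) where
  open Ring R

  IsUnit : Carrier → Set (c ⊔ ℓ)
  IsUnit u = ∃ λ w → (u * w ≈ 1#) × (w * u ≈ 1#)

  UnitsCommutative : Set (c ⊔ ℓ)
  UnitsCommutative = ∀ u v → IsUnit u → IsUnit v → u * v ≈ v * u

{-# OPTIONS --safe #-}
module Submission where

-- Choose a generator a of every black point and a linear form f with kernel ℓ for every white
-- hyperplane.  The values f(a) along edges are units, and a tile is coherent iff the alternating
-- product of the four values around it is 1.  So realizations are connections on the graph with
-- values in R^×, coherence is flatness, and conversely every connection arises by taking basis
-- vectors as points.
--
-- Gluing tiles one after another to the exceptional tile turns the surface into a polygon with
-- boundary word L, in which every remaining edge occurs once in each direction.  A connection flat
-- off the exceptional tile has the same holonomy there as along L, and any values on the sides of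
-- L extend to such a connection.  If R^× is commutative the holonomy along L cancels.  Otherwise,
-- if two edges x, y interlace in L as x … y … x⁻¹ … y⁻¹, then putting u on x, v on y and 1
-- elsewhere makes the holonomy the commutator of u and v.  If no two edges interlace, L is the
-- contour of a plane tree, so there is one more vertex than there are edges in L, and Euler's
-- formula gives genus 0.

open import Defs
open import Algebra.Bundles using (Ring; Group)
open import Data.Nat using (ℕ; _≤_; _∸_)
open import Function.Bundles using (_⇔_)
import Algebra.Properties.CommutativeSemigroup as CommutativeSemigroupProperties
import Algebra.Properties.Group as GroupProperties
import Algebra.Properties.Ring as RingProperties
import Algebra.Properties.Semiring.Sum as SemiringSum
open import Data.Empty using (⊥; ⊥-elim)
open import Data.Fin using (Fin; zero; suc; _≟_; splitAt; join; inject≤; punchIn)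
open import Data.Fin.Properties
  using (injective⇒≤; splitAt-join; join-splitAt; any?; inject≤-injective; punchInᵢ≢i)
open import Data.List using (List; []; _∷_; [_]; _++_; length; lookup)
open import Data.List.Properties using (length-++)
open import Data.List.Membership.Propositional using (_∈_; _∉_; find)
open import Data.List.Membership.Propositional.Properties
  using (∈-++⁺ˡ; ∈-++⁺ʳ; ∈-++⁻; ∈-∃++; ∈-insert; ∈-lookup)
open import Data.List.Relation.Unary.All as All using (All; []; _∷_)
open import Data.List.Relation.Unary.All.Properties using (¬All⇒Any¬; All¬⇒¬Any)
  renaming (++⁺ to All-++⁺)
open import Data.List.Relation.Unary.Any as Any using (here; there; index)
open import Data.List.Relation.Unary.Any.Properties using (lookup-index)
open import Data.List.Relation.Unary.AllPairs using ([]; _∷_)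
open import Data.List.Relation.Unary.Unique.Propositional using (Unique)
import Data.List.Relation.Unary.Unique.Propositional.Properties as Unique
open import Data.List.Relation.Binary.Permutation.Propositional
  using (_↭_; prep; ↭-sym; ↭-trans; ↭⇒↭ₛ)
open import Data.List.Relation.Binary.Permutation.Propositional.Properties
  using (∈-resp-↭; shift; shifts; ++⁺ʳ; ↭-length)
import Data.List.Relation.Binary.Permutation.Setoid.Properties as Permₛ
open import Data.List.Relation.Binary.Sublist.Propositional
  using (_⊆_; []; _∷_; _∷ʳ_; ⊆-refl; from∈)
import Data.List.Relation.Binary.Sublist.Propositional.Properties as Sub
open import Data.Nat as ℕ using (zero; suc; s≤s)
import Data.Nat.Properties as ℕ
open import Data.Product using (Σ; ∃; ∃₂; _×_; _,_; proj₁; proj₂)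
open import Data.Sum using (_⊎_; inj₁; inj₂; [_,_]′)
open import Data.Sum.Properties using (≡-dec)
open import Data.Unit.Polymorphic using (tt)
open import Data.Vec.Functional using (removeAt)
open import Function.Base using (_∘_; id)
open import Function.Bundles using (mk⇔; Equivalence)
open import Level using (_⊔_; Lift; lift; lower) renaming (suc to lsuc)
open import Relation.Binary.PropositionalEquality as ≡ using (_≡_; _≢_)
import Relation.Binary.Reasoning.Setoid as SetoidReasoning
open import Relation.Nullary using (¬_; yes; no; Dec; contradiction)
open import Relation.Nullary.Decidable using (_×-dec_)

open Equivalence using (to; from)

-- Lists without repetition, and counting with them.

module _ {a} {A : Set a} where
  open ≡ using (refl; sym; cong; subst)

  Unique-resp-↭ : ∀ {xs ys : List A} → xs ↭ ys → Unique xs → Unique ys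
  Unique-resp-↭ p = Permₛ.Unique-resp-↭ (≡.setoid A) (↭⇒↭ₛ p)

  Unique-head : ∀ {x : A} {xs} → Unique (x ∷ xs) → x ∉ xs
  Unique-head (px ∷ _) = All¬⇒¬Any px

  Unique-tail : ∀ {x : A} {xs} → Unique (x ∷ xs) → Unique xs
  Unique-tail (_ ∷ u) = u

  Unique-cons : ∀ {x : A} {xs} → x ∉ xs → Unique xs → Unique (x ∷ xs)
  Unique-cons x∉ u = All.tabulate (λ y∈ x≡y → x∉ (subst (_∈ _) (sym x≡y) y∈)) ∷ u

  Unique-⊆ : ∀ {xs ys : List A} → xs ⊆ ys → Unique ys → Unique xs
  Unique-⊆ [] u = []
  Unique-⊆ (y ∷ʳ p) (_ ∷ u) = Unique-⊆ p u
  Unique-⊆ (refl ∷ p) (py ∷ u) = Sub.All-resp-⊆ p py ∷ Unique-⊆ p u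

  Unique-++ˡ : ∀ xs {ys : List A} → Unique (xs ++ ys) → Unique xs
  Unique-++ˡ xs = Unique-⊆ (Sub.++⁺ʳ _ ⊆-refl)

  Unique-++ʳ : ∀ xs {ys : List A} → Unique (xs ++ ys) → Unique ys
  Unique-++ʳ xs = Unique-⊆ (Sub.++⁺ˡ xs ⊆-refl)

  Unique-disjoint : ∀ xs {ys : List A} {z} → Unique (xs ++ ys) → z ∈ xs → z ∉ ys
  Unique-disjoint (x ∷ xs) u (here refl) z∈ys = Unique-head u (∈-++⁺ʳ xs z∈ys)
  Unique-disjoint (x ∷ xs) u (there z∈xs) = Unique-disjoint xs (Unique-tail u) z∈xs

  lookup-injective : ∀ {xs : List A} → Unique xs → ∀ {i j} → lookup xs i ≡ lookup xs j → i ≡ j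
  lookup-injective {x ∷ xs} u {zero} {zero} eq = refl
  lookup-injective {x ∷ xs} u {zero} {suc j} eq =
    ⊥-elim (Unique-head u (subst (_∈ xs) (sym eq) (∈-lookup j)))
  lookup-injective {x ∷ xs} u {suc i} {zero} eq =
    ⊥-elim (Unique-head u (subst (_∈ xs) eq (∈-lookup i)))
  lookup-injective {x ∷ xs} u {suc i} {suc j} eq = cong suc (lookup-injective (Unique-tail u) eq)

Unique⇒length≤ : ∀ {n} {xs : List (Fin n)} → Unique xs → length xs ≤ n
Unique⇒length≤ u = injective⇒≤ (lookup-injective u)

full⇒≤length : ∀ {n} {xs : List (Fin n)} → (∀ i → i ∈ xs) → n ≤ length xs
full⇒≤length {xs = xs} full = injective⇒≤ {f = λ i → index (full i)} λ {i} {j} eq →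
  ≡.trans (lookup-index (full i)) (≡.trans (≡.cong (lookup xs) eq) (≡.sym (lookup-index (full j))))

-- Darts and the tiles they bound.

module Tiling (T : QuadTiling) where
  open QuadTiling T
  open ≡ using (refl; sym; trans; cong; cong₂; subst)

  Dart = Fin nDart
  Face = Fin nFace

  open import Data.List.Membership.DecPropositional (_≟_ {nDart}) using () renaming (_∈?_ to _∈ᵈ?_)
  open import Data.List.Membership.DecPropositional (_≟_ {nFace}) using () renaming (_∈?_ to _∈ᶠ?_)

  φ : Dart → Dart
  φ x = σ (α x)

  tile : Dart → List Dart
  tile x = x ∷ φ x ∷ φ (φ x) ∷ φ (φ (φ x)) ∷ []

  φα : ∀ x → φ (α x) ≡ σ x
  φα x = cong σ (α-invol x)

  face-φ : ∀ x → face (φ x) ≡ face x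
  face-φ x = sym (face-orbit x (φ x) .from (1 , refl))

  vertex-σ : ∀ x → vertex (σ x) ≡ vertex x
  vertex-σ x = sym (vertex-orbit x (σ x) .from (1 , refl))

  ∈tile⇒face : ∀ {x y} → y ∈ tile x → face y ≡ face x
  ∈tile⇒face (here refl) = refl
  ∈tile⇒face (there (here refl)) = face-φ _
  ∈tile⇒face (there (there (here refl))) = trans (face-φ _) (face-φ _)
  ∈tile⇒face (there (there (there (here refl)))) = trans (face-φ _) (trans (face-φ _) (face-φ _))

  -- The orbit of `x` under `φ` closes after four steps, so no iterate leaves `tile x`.
  face⇒∈tile : ∀ {x y} → face y ≡ face x → y ∈ tile x
  face⇒∈tile {x} {y} eq with face-orbit x y .to (sym eq)
  ... | k , refl = iter-∈ k
    where
    iter-∈ : ∀ k → iter φ k x ∈ tile x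
    iter-∈ zero = here refl
    iter-∈ (suc k) with iter-∈ k
    ... | here p = there (here (cong φ p))
    ... | there (here p) = there (there (here (cong φ p)))
    ... | there (there (here p)) = there (there (there (here (cong φ p))))
    ... | there (there (there (here p))) = here (trans (cong φ p) (quadrilateral x))

  Bip-irrefl : ∀ (v : Fin nBlack ⊎ Fin nWhite) → ¬ Bip v v
  Bip-irrefl (inj₁ _) ()
  Bip-irrefl (inj₂ _) ()

  vertex-≢ : ∀ x → vertex x ≢ vertex (α x)
  vertex-≢ x eq = Bip-irrefl _ (subst (Bip (vertex x)) (sym eq) (bipartite x))

  φ-≢ : ∀ x → x ≢ φ x
  φ-≢ x eq = vertex-≢ x (trans (cong vertex eq) (vertex-σ (α x)))

  φφ-≢ : ∀ x → x ≢ φ (φ x)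
  φφ-≢ x eq = embedded x (cong vertex eq)

  tile-unique : ∀ x → Unique (tile x)
  tile-unique x =
    (φ-≢ x ∷ φφ-≢ x ∷ (λ eq → φ-≢ x (sym (trans (cong φ eq) (quadrilateral x)))) ∷ []) ∷
    (φ-≢ _ ∷ φφ-≢ _ ∷ []) ∷ (φ-≢ _ ∷ []) ∷ [] ∷ []

  -- Growing a disc tile by tile.

  -- The disc grown from the tile of x₀ by gluing the tile of α x along a boundary edge x when
  -- that tile is still outside: Fs are its tiles, L its boundary word, D the erased interior darts.
  data Grown (x₀ : Dart) : List Face → List Dart → List Dart → Set where
    start  : Grown x₀ [ face x₀ ] (tile x₀) []
    absorb : ∀ {Fs D} A x B → Grown x₀ Fs (A ++ x ∷ B) D → face (α x) ∉ Fs →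
             Grown x₀ (face (α x) ∷ Fs)
               (A ++ φ (α x) ∷ φ (φ (α x)) ∷ φ (φ (φ (α x))) ∷ B) (x ∷ α x ∷ D)

  -- Gluing adds exactly the four darts of `tile (α x)`: `x` passes from the boundary to the
  -- interior, and `α x` goes there at once. Counting, uniqueness and coverage of darts all rest on
  -- this.
  absorb-↭ : ∀ A x B D → (A ++ φ (α x) ∷ φ (φ (α x)) ∷ φ (φ (φ (α x))) ∷ B) ++ x ∷ α x ∷ D ↭
                         tile (α x) ++ (A ++ x ∷ B) ++ D
  absorb-↭ A x B D =
    ↭-trans (++⁺ʳ (x ∷ α x ∷ D) (shifts A (p ∷ q ∷ r ∷ [])))
    (↭-trans (prep p (prep q (prep r
       (↭-trans (shift x (A ++ B) (α x ∷ D)) (prep x (shift (α x) (A ++ B) D))))))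
    (↭-trans (shift (α x) (p ∷ q ∷ r ∷ x ∷ []) ((A ++ B) ++ D))
    (↭-sym (prep (α x) (prep p (prep q (prep r (++⁺ʳ D (shift x A B)))))))))
    where
    p q r : Dart
    p = φ (α x)
    q = φ p
    r = φ q

  module _ {x₀ : Dart} where

    covered : ∀ {Fs L D d} → Grown x₀ Fs L D → d ∈ L ++ D → face d ∈ Fs
    covered start d∈ = here (∈tile⇒face d∈)
    covered (absorb A x B gr f∉) d∈ with ∈-++⁻ (tile (α x)) (∈-resp-↭ (absorb-↭ A x B _) d∈)
    ... | inj₁ d∈t = here (∈tile⇒face d∈t)
    ... | inj₂ d∈L = there (covered gr d∈L)

    covers : ∀ {Fs L D d} → Grown x₀ Fs L D → face d ∈ Fs → d ∈ L ++ D
    covers start (here eq) = face⇒∈tile eq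
    covers (absorb A x B gr f∉) (here eq) =
      ∈-resp-↭ (↭-sym (absorb-↭ A x B _)) (∈-++⁺ˡ (face⇒∈tile eq))
    covers (absorb A x B gr f∉) (there f∈) =
      ∈-resp-↭ (↭-sym (absorb-↭ A x B _)) (∈-++⁺ʳ (tile (α x)) (covers gr f∈))

    darts-unique : ∀ {Fs L D} → Grown x₀ Fs L D → Unique (L ++ D)
    darts-unique start = tile-unique x₀
    darts-unique (absorb A x B gr f∉) = Unique-resp-↭ (↭-sym (absorb-↭ A x B _))
      (Unique.++⁺ (tile-unique (α x)) (darts-unique gr)
        λ (d∈t , d∈L) → f∉ (subst (_∈ _) (∈tile⇒face d∈t) (covered gr d∈L)))

    faces-unique : ∀ {Fs L D} → Grown x₀ Fs L D → Unique Fs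
    faces-unique start = [] ∷ []
    faces-unique (absorb A x B gr f∉) = Unique-cons f∉ (faces-unique gr)

    length-darts : ∀ {Fs L D} → Grown x₀ Fs L D → length (L ++ D) ≡ length Fs ℕ.* 4
    length-darts start = refl
    length-darts (absorb A x B gr f∉) =
      trans (↭-length (absorb-↭ A x B _)) (cong (4 ℕ.+_) (length-darts gr))

    -- Each gluing trades one side for three, which makes two more sides per tile.
    length-word : ∀ {Fs L D} → Grown x₀ Fs L D → length L ≡ 2 ℕ.+ length Fs ℕ.* 2
    length-word start = refl
    length-word (absorb A x B gr f∉) =
      trans (↭-length (shifts A (_ ∷ _ ∷ _ ∷ [])))
        (cong (2 ℕ.+_) (trans (sym (↭-length (shift x A B))) (length-word gr)))

    D-closed : ∀ {Fs L D d} → Grown x₀ Fs L D → d ∈ D → α d ∈ D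
    D-closed (absorb A x B gr f∉) (here refl) = there (here refl)
    D-closed (absorb A x B gr f∉) (there (here refl)) = here (α-invol x)
    D-closed (absorb A x B gr f∉) (there (there d∈)) = there (there (D-closed gr d∈))

    x₀-face : ∀ {Fs L D} → Grown x₀ Fs L D → face x₀ ∈ Fs
    x₀-face start = here refl
    x₀-face (absorb A x B gr f∉) = there (x₀-face gr)

  Closed : List Dart → Set
  Closed L = ∀ {d} → d ∈ L → α d ∈ L

  record Cut (x₀ : Dart) : Set where
    field
      {faces} : List Face
      {word interior} : List Dart
      grown : Grown x₀ faces word interior
      closed : Closed word
      full : ∀ d → face d ∈ faces

  -- Once nothing can be glued, the opposite of a side is in the disc but not among the erased
  -- darts, which are closed under `α`; so it is again a side. The covered darts are then stable
  -- under `α` and under `σ`, which is `φ` after `α`, and connectedness gives all of them.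
  finish : ∀ {x₀ Fs L D} → Grown x₀ Fs L D → All (λ x → face (α x) ∈ Fs) L → Cut x₀
  finish {x₀} {Fs} {L} {D} gr done = record { grown = gr ; closed = closed ; full = full }
    where
    L∌D : ∀ {d} → d ∈ L → d ∉ D
    L∌D = Unique-disjoint L (darts-unique gr)
    closed : Closed L
    closed {d} d∈L with ∈-++⁻ L (covers gr (All.lookup done d∈L))
    ... | inj₁ αd∈L = αd∈L
    ... | inj₂ αd∈D = ⊥-elim (L∌D d∈L (subst (_∈ D) (α-invol d) (D-closed gr αd∈D)))
    full-α : ∀ {d} → face d ∈ Fs → face (α d) ∈ Fs
    full-α f∈ with ∈-++⁻ L (covers gr f∈)
    ... | inj₁ d∈L = All.lookup done d∈L
    ... | inj₂ d∈D = covered gr (∈-++⁺ʳ L (D-closed gr d∈D))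
    reach : ∀ {d} → Reach σ α x₀ d → face d ∈ Fs
    reach here = x₀-face gr
    reach (viaα p) = full-α (reach p)
    reach (viaσ {y} p) = subst (_∈ Fs)
      (trans (sym (face-φ (α y))) (cong face (φα y))) (full-α (reach p))
    full : ∀ d → face d ∈ Fs
    full d = reach (connected x₀ d)

  cut : ∀ x₀ → Cut x₀
  cut x₀ = grow nFace start (ℕ.m≤m+n nFace 1)
    where
    -- `fuel` bounds the number of tiles outside the disc; at zero, another gluing would give more
    -- than `nFace` distinct tiles.
    grow : ∀ {Fs L D} fuel → Grown x₀ Fs L D → nFace ≤ fuel ℕ.+ length Fs → Cut x₀
    grow {Fs} {L} fuel gr bound with All.all? (λ x → face (α x) ∈ᶠ? Fs) L
    ... | yes done = finish gr done
    ... | no ¬done with find (¬All⇒Any¬ (λ x → face (α x) ∈ᶠ? Fs) L ¬done)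
    ... | x , x∈L , f∉ with ∈-∃++ x∈L
    ... | A , B , refl = continue fuel (absorb A x B gr f∉) bound
      where
      continue : ∀ {Gs f L D} fuel → Grown x₀ (f ∷ Gs) L D → nFace ≤ fuel ℕ.+ length Gs → Cut x₀
      continue zero gr bound = ⊥-elim (ℕ.<⇒≱ (Unique⇒length≤ (faces-unique gr)) bound)
      continue (suc fuel) gr bound = grow fuel gr (subst (nFace ≤_) (sym (ℕ.+-suc fuel _)) bound)

  -- Turns around a vertex, corners of the boundary word, and plane trees.

  node-⊆ˡ : ∀ {x y : Dart} K {L} → K ⊆ x ∷ K ++ y ∷ L
  node-⊆ˡ K = _ ∷ʳ Sub.++⁺ʳ _ ⊆-refl

  node-⊆ʳ : ∀ {x y : Dart} K {L} → L ⊆ x ∷ K ++ y ∷ L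
  node-⊆ʳ K = _ ∷ʳ Sub.++⁺ˡ K (_ ∷ʳ ⊆-refl)

  -- A turn by `σ` around one vertex. The end dart is exempt from `S`, so that turns compose and a
  -- turn may stop at a side of the word, which is not an erased dart.
  data Arc (S : Dart → Set) : Dart → Dart → Set where
    []  : ∀ {c} → Arc S c c
    _∷_ : ∀ {c c′} → S c → Arc S (σ c) c′ → Arc S c c′

  module _ {S : Dart → Set} where

    _⟫_ : ∀ {c c′ c″} → Arc S c c′ → Arc S c′ c″ → Arc S c c″
    [] ⟫ q = q
    (s ∷ p) ⟫ q = s ∷ (p ⟫ q)

    Arc-map : ∀ {S′ : Dart → Set} {c c′} → (∀ {d} → S d → S′ d) → Arc S c c′ → Arc S′ c c′
    Arc-map f [] = []
    Arc-map f (s ∷ p) = f s ∷ Arc-map f p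

    Arc-vertex : ∀ {c c′} → Arc S c c′ → vertex c ≡ vertex c′
    Arc-vertex [] = refl
    Arc-vertex (_∷_ {c} s p) = trans (sym (vertex-σ c)) (Arc-vertex p)

    -- A closed turn runs through the whole orbit of `σ`, and every dart at the vertex is in that
    -- orbit.
    Arc-orbit : ∀ {c} → S c → Arc S (σ c) c → ∀ {d} → vertex d ≡ vertex c → S d
    Arc-orbit {c} s loop {d} eq with vertex-orbit c d .to (sym eq)
    ... | k , refl = along k (s ∷ loop)
      where
      iter-σ : ∀ k d → iter σ k (σ d) ≡ σ (iter σ k d)
      iter-σ zero d = refl
      iter-σ (suc k) d = cong σ (iter-σ k d)
      along : ∀ k {d} → Arc S d c → S (iter σ k d)
      along zero [] = s
      along zero (t ∷ p) = t
      -- Back at `c`, the loop is run again.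
      along (suc k) [] = subst S (iter-σ k c) (along k loop)
      along (suc k) {d} (t ∷ p) = subst S (iter-σ k d) (along k p)

  -- A corner of the word L is marked by a dart c such that rotating from c one meets only darts
  -- of D before the next side of L; the corner after the side x is marked by σ (α x) = φ x.
  Corners : List Dart → Dart → List Dart → Dart → Set
  Corners D c [] c′ = Arc (_∈ D) c c′
  Corners D c (x ∷ L) c′ = Arc (_∈ D) c x × Corners D (φ x) L c′

  Corners-split : ∀ {D c c′} K {x L} → Corners D c (K ++ x ∷ L) c′ →
                  Corners D c K x × Corners D (φ x) L c′
  Corners-split [] p = p
  Corners-split (k ∷ K) (p , ps) with Corners-split K ps
  ... | q , r = (p , q) , r

  Corners-mono : ∀ {D D′ c c′} L → (∀ {d} → d ∈ D → d ∈ D′) → Corners D c L c′ → Corners D′ c L c′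
  Corners-mono [] f p = Arc-map f p
  Corners-mono (x ∷ L) f (p , ps) = Arc-map f p , Corners-mono L f ps

  Corners-extend : ∀ {D c c′} L → c ∈ D → Corners D (σ c) L c′ → Corners D c L c′
  Corners-extend [] c∈ p = c∈ ∷ p
  Corners-extend (x ∷ L) c∈ (p , ps) = c∈ ∷ p , ps

  -- Only the two corners at the ends of `x` change. The one before `x` is prolonged past `x` to
  -- `σ x`, the first new side; the one after the last new side begins at `α x`, where four steps of
  -- `φ` close the tile, and one rotation takes it to the old corner `φ x`. Between new sides the
  -- turns are trivial.
  Corners-absorb : ∀ {D c c′} A x B → Corners D c (A ++ x ∷ B) c′ →
    Corners (x ∷ α x ∷ D) c (A ++ φ (α x) ∷ φ (φ (α x)) ∷ φ (φ (φ (α x))) ∷ B) c′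
  Corners-absorb [] x B (p , ps) =
    (Arc-map (there ∘ there) p ⟫ (here refl ∷ subst (Arc _ (σ x)) (sym (φα x)) [])) , [] , [] ,
    subst (λ c → Corners _ c B _) (sym (quadrilateral (α x)))
      (Corners-extend B (there (here refl)) (Corners-mono B (there ∘ there) ps))
  Corners-absorb (a ∷ A) x B (p , ps) = Arc-map (there ∘ there) p , Corners-absorb A x B ps

  Grown⇒Corners : ∀ {x₀ Fs L D} → Grown x₀ Fs L D → Corners D x₀ L x₀
  Grown⇒Corners {x₀} start = [] , [] , [] , [] , subst (Arc _ _) (quadrilateral x₀) []
  Grown⇒Corners (absorb A x B gr f∉) = Corners-absorb A x B (Grown⇒Corners gr)

  data Dyck : List Dart → Set where
    []   : Dyck []
    node : ∀ {x K L} → Dyck K → Dyck L → Dyck (x ∷ K ++ α x ∷ L)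

  -- The rotation that passes `x` arrives at `σ x`, which is `φ (α x)`, the corner after `α x`. A
  -- subtree is thus skipped in one step, and the corners at the root join into one turn.
  Dyck-arc : ∀ {D c c′ L} → Dyck L → Corners D c L c′ → Arc (_∈ L ++ D) c c′
  Dyck-arc [] p = p
  Dyck-arc {D} {c} {c′} (node {x} {K} {L} dK dL) (p , ps) with Corners-split K ps
  ... | _ , pL = Arc-map (there ∘ ∈-++⁺ʳ (K ++ α x ∷ L)) p ⟫
    (here refl ∷ Arc-map (Sub.Any-resp-⊆ (Sub.++⁺ (node-⊆ʳ K) ⊆-refl))
      (Dyck-arc dL (subst (λ d → Corners D d L c′) (φα x) pL)))

  -- Serves to tell vertices apart by darts: all darts at `v` are confined to one word and `D`, and
  -- the witness lies in the word itself, so vertices inner to disjoint words differ.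
  record Inner (L D : List Dart) (v : Fin nBlack ⊎ Fin nWhite) : Set where
    constructor inner
    field
      {witness} : Dart
      witness∈ : witness ∈ L
      at-v : vertex witness ≡ v
      surrounded : ∀ {d} → vertex d ≡ v → d ∈ L ++ D

  open Inner

  Inner-mono : ∀ {K L D v} → K ⊆ L → Inner K D v → Inner L D v
  Inner-mono K⊆L (inner w∈ eq f) = inner (Sub.Any-resp-⊆ K⊆L w∈) eq
    (Sub.Any-resp-⊆ (Sub.++⁺ K⊆L ⊆-refl) ∘ f)

  -- A Dyck word is the contour of a plane tree: each of its edges has a child end, whose darts
  -- all occur in that edge and the subtree beyond it.
  Dyck-vertices : ∀ {D c c′ L} → Dyck L → Unique (L ++ D) → Corners D c L c′ →
    ∃ λ vs → Unique (vertex c ∷ vs) × All (Inner L D) vs × length L ≡ length vs ℕ.* 2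
  Dyck-vertices [] u p = [] , [] ∷ [] , [] , refl
  Dyck-vertices {D} {c} {c′} (node {x} {K} {L} dK dL) u (p , ps) with Corners-split K ps
  ... | pK , pL
    with Dyck-vertices dK (Unique-⊆ (Sub.++⁺ (node-⊆ˡ K) ⊆-refl) u) pK
       | Dyck-vertices dL (Unique-⊆ (Sub.++⁺ (node-⊆ʳ K) ⊆-refl) u) pL
  ... | us , uus , iK , lenK | ws , uws , iL , lenL =
    v ∷ us ++ ws ,
    Unique-cons c∉ (Unique-cons v∉ (Unique.++⁺ (Unique-tail uus) (Unique-tail uws) disj)) ,
    inner (there (∈-insert K)) refl around-v ∷
      All-++⁺ (All.map (Inner-mono (node-⊆ˡ K)) iK) (All.map (Inner-mono (node-⊆ʳ K)) iL) ,
    len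
    where
    v : Fin nBlack ⊎ Fin nWhite
    v = vertex (α x)
    c≡x : vertex c ≡ vertex x
    c≡x = Arc-vertex p
    uW : Unique ((x ∷ K ++ α x ∷ L))
    uW = Unique-++ˡ _ u
    x∉K : x ∉ K ++ D
    x∉K x∈ = [ (λ x∈K → Unique-head uW (∈-++⁺ˡ x∈K)) , Unique-disjoint _ u (here refl) ]′ (∈-++⁻ K x∈)
    αx∉L : α x ∉ L ++ D
    αx∉L αx∈ = [ Unique-head (Unique-++ʳ K (Unique-tail uW)) ,
                 Unique-disjoint _ u (there (∈-insert K)) ]′ (∈-++⁻ L αx∈)
    K∉L : ∀ {d} → d ∈ K → d ∉ L ++ D
    K∉L d∈K d∈ = [ Unique-disjoint K (Unique-tail uW) d∈K ∘ there ,
                   Unique-disjoint _ u (there (∈-++⁺ˡ d∈K)) ]′ (∈-++⁻ L d∈)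
    disj : ∀ {w} → w ∈ us × w ∈ ws → ⊥
    disj (w∈us , w∈ws) with All.lookup iK w∈us
    ... | inner w∈ eq _ = K∉L w∈ (All.lookup iL w∈ws .surrounded eq)
    -- `K` is rooted at `v`, since its first corner `φ x` is `σ (α x)`; `L` is rooted at the vertex
    -- of `x`.
    v∉ : v ∉ us ++ ws
    v∉ v∈ with ∈-++⁻ us v∈
    ... | inj₁ v∈us = Unique-head uus (subst (_∈ us) (sym (vertex-σ (α x))) v∈us)
    ... | inj₂ v∈ws = αx∉L (All.lookup iL v∈ws .surrounded refl)
    c∉ : vertex c ∉ v ∷ us ++ ws
    c∉ (here eq) = vertex-≢ x (trans (sym c≡x) eq)
    c∉ (there c∈) with ∈-++⁻ us c∈
    ... | inj₁ c∈us = x∉K (All.lookup iK c∈us .surrounded (sym c≡x))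
    ... | inj₂ c∈ws = Unique-head uws
      (subst (_∈ ws) (trans c≡x (sym (trans (cong vertex (φα x)) (vertex-σ x)))) c∈ws)
    -- The corners of `K` run from `σ (α x)` to `α x`, so their turn closes up around `v`.
    around-v : ∀ {d} → vertex d ≡ v → d ∈ x ∷ (K ++ α x ∷ L) ++ D
    around-v = Arc-orbit (there (∈-++⁺ˡ (∈-insert K)))
      (Arc-map (Sub.Any-resp-⊆ (Sub.++⁺ (node-⊆ˡ K) ⊆-refl)) (Dyck-arc dK pK))
    len : length (x ∷ K ++ α x ∷ L) ≡ length (v ∷ us ++ ws) ℕ.* 2
    len = trans (cong suc (↭-length (shift (α x) K L)))
      (cong (2 ℕ.+_) (trans (length-++ K) (trans (cong₂ ℕ._+_ lenK lenL)
        (sym (trans (cong (ℕ._* 2) (length-++ us)) (ℕ.*-distribʳ-+ 2 (length us) (length ws)))))))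

  -- Interlacing sides of a word.

  Crossing : List Dart → Set
  Crossing L = ∃₂ λ x y → x ∷ y ∷ α x ∷ α y ∷ [] ⊆ L

  -- Let `K` be the part between the first side `x` and `α x`, and `M` the rest. If `K` is closed
  -- under `α`, then so is `M`, and the word splits into two shorter ones; otherwise some `y` in `K`
  -- has `α y` in `M` and interlaces with `x`.
  Dyck⊎Crossing : ∀ {L} → Unique L → Closed L → Dyck L ⊎ Crossing L
  Dyck⊎Crossing {L} = go (length L) ℕ.≤-refl
    where
    go : ∀ n {L} → length L ≤ n → Unique L → Closed L → Dyck L ⊎ Crossing L
    go n {[]} _ _ _ = inj₁ []
    go (suc n) {x ∷ L} (s≤s len) u cl with cl (here refl)
    ... | here eq = ⊥-elim (α-free x eq)
    ... | there αx∈ with ∈-∃++ αx∈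
    ... | K , M , refl with All.all? (λ y → α y ∈ᵈ? K) K
    ...   | no ¬cK with find (¬All⇒Any¬ (λ y → α y ∈ᵈ? K) K ¬cK)
    ...     | y , y∈K , αy∉K = inj₂ (x , y , refl ∷ Sub.++⁺ (from∈ y∈K) (refl ∷ from∈ αy∈M))
      where
      αy∈M : α y ∈ M
      αy∈M with cl (there (∈-++⁺ˡ y∈K))
      ... | here eq = ⊥-elim (Unique-disjoint K (Unique-tail u) y∈K
              (here (trans (sym (α-invol y)) (cong α eq))))
      ... | there αy∈ with ∈-++⁻ K αy∈
      ...   | inj₁ αy∈K = ⊥-elim (αy∉K αy∈K)
      ...   | inj₂ (there αy∈M) = αy∈M
      ...   | inj₂ (here eq) = ⊥-elim (Unique-head u (∈-++⁺ˡ
                (subst (_∈ K) (trans (sym (α-invol y)) (trans (cong α eq) (α-invol x))) y∈K)))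
    go (suc n) {x ∷ .(K ++ α x ∷ M)} (s≤s len) u cl | there αx∈ | K , M , refl | yes cK
      with go n (ℕ.≤-trans (Sub.length-mono-≤ K⊆) len) (Unique-⊆ K⊆ (Unique-tail u)) (All.lookup cK)
         | go n (ℕ.≤-trans (Sub.length-mono-≤ M⊆) len) (Unique-⊆ M⊆ (Unique-tail u)) cM
      where
      K⊆ : K ⊆ K ++ α x ∷ M
      K⊆ = Sub.++⁺ʳ _ ⊆-refl
      M⊆ : M ⊆ K ++ α x ∷ M
      M⊆ = Sub.++⁺ˡ K (α x ∷ʳ ⊆-refl)
      cM : Closed M
      cM {y} y∈M with cl (there (Sub.Any-resp-⊆ M⊆ y∈M))
      ... | here eq = ⊥-elim (Unique-head (Unique-++ʳ K (Unique-tail u))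
              (subst (_∈ M) (trans (sym (α-invol y)) (cong α eq)) y∈M))
      ... | there αy∈ with ∈-++⁻ K αy∈
      ...   | inj₁ αy∈K = ⊥-elim (Unique-disjoint K (Unique-tail u)
                (subst (_∈ K) (α-invol y) (All.lookup cK αy∈K)) (there y∈M))
      ...   | inj₂ (there αy∈M) = αy∈M
      ...   | inj₂ (here eq) = ⊥-elim (Unique-head u (Sub.Any-resp-⊆ M⊆
                (subst (_∈ M) (trans (sym (α-invol y)) (trans (cong α eq) (α-invol x))) y∈M)))
    ... | inj₁ dK | inj₁ dM = inj₁ (node dK dM)
    ... | inj₂ (y , z , cr) | _ = inj₂ (y , z , x ∷ʳ Sub.++⁺ʳ _ cr)
    ... | _ | inj₂ (y , z , cr) = inj₂ (y , z , x ∷ʳ Sub.++⁺ˡ K (α x ∷ʳ cr))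

  -- Counting vertices, edges and faces.

  Unique-vertices⇒length≤ : ∀ {vs} → Unique vs → length vs ≤ nBlack ℕ.+ nWhite
  Unique-vertices⇒length≤ {vs} u = injective⇒≤ {f = λ i → join nBlack nWhite (lookup vs i)} λ {i} {j} eq →
    lookup-injective u (trans (sym (splitAt-join nBlack nWhite (lookup vs i)))
      (trans (cong (splitAt nBlack) eq) (splitAt-join nBlack nWhite (lookup vs j))))

  -- Each edge contributes a chosen dart and its opposite, which differ because `α` has no fixed
  -- point.
  2nEdge≤nDart : nEdge ℕ.+ nEdge ≤ nDart
  2nEdge≤nDart = injective⇒≤ {f = λ i → dart (splitAt nEdge i)} λ {i} {j} eq →
    trans (sym (join-splitAt nEdge nEdge i))
      (trans (cong (join nEdge nEdge) (dart-injective (splitAt nEdge i) (splitAt nEdge j) eq))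
        (join-splitAt nEdge nEdge j))
    where
    dart : Fin nEdge ⊎ Fin nEdge → Dart
    dart (inj₁ e) = edge-surj e .proj₁
    dart (inj₂ e) = α (edge-surj e .proj₁)
    edge-α : ∀ x → edge (α x) ≡ edge x
    edge-α x = sym (edge-orbit x (α x) .from (inj₂ refl))
    edge-dart₁ : ∀ e → edge (dart (inj₁ e)) ≡ e
    edge-dart₁ e = edge-surj e .proj₂
    edge-dart₂ : ∀ e → edge (dart (inj₂ e)) ≡ e
    edge-dart₂ e = trans (edge-α _) (edge-dart₁ e)
    dart-injective : ∀ s t → dart s ≡ dart t → s ≡ t
    dart-injective (inj₁ e) (inj₁ e′) eq =
      cong inj₁ (trans (sym (edge-dart₁ e)) (trans (cong edge eq) (edge-dart₁ e′)))
    dart-injective (inj₂ e) (inj₂ e′) eq =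
      cong inj₂ (trans (sym (edge-dart₂ e)) (trans (cong edge eq) (edge-dart₂ e′)))
    dart-injective (inj₁ e) (inj₂ e′) eq
      with refl ← trans (sym (edge-dart₁ e)) (trans (cong edge eq) (edge-dart₂ e′)) =
      ⊥-elim (α-free _ (sym eq))
    dart-injective (inj₂ e) (inj₁ e′) eq
      with refl ← trans (sym (edge-dart₂ e)) (trans (cong edge eq) (edge-dart₁ e′)) =
      ⊥-elim (α-free _ eq)

  -- Let `k` tiles be glued. The word has `2 + 2k` sides, so a plane tree with this contour has
  -- `k + 1` edges and `k + 2` distinct vertices. The `4k` darts give at most `2k` edges of the
  -- tiling. As `k` is at most `nFace`, Euler's formula leaves no room for positive genus.
  ¬Dyck-cut : ∀ {x₀} (C : Cut x₀) → ¬ Dyck (Cut.word C)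
  ¬Dyck-cut C dyck with Dyck-vertices dyck (darts-unique (Cut.grown C)) (Grown⇒Corners (Cut.grown C))
  ... | vs , uvs , _ , len = ℕ.<-irrefl refl (begin-strict
      2 ℕ.+ k ℕ.+ nFace                              <⟨ ℕ.m<m+n _ {2 ℕ.* genus} 0<2g ⟩
      2 ℕ.+ k ℕ.+ nFace ℕ.+ 2 ℕ.* genus             ≤⟨ ℕ.+-monoˡ-≤ (2 ℕ.* genus) (ℕ.+-monoˡ-≤ nFace V≥) ⟩
      nBlack ℕ.+ nWhite ℕ.+ nFace ℕ.+ 2 ℕ.* genus   ≡⟨ euler ⟩
      2 ℕ.+ nEdge                                    ≤⟨ ℕ.+-monoʳ-≤ 2 E≤ ⟩
      2 ℕ.+ (k ℕ.+ k)                                ≤⟨ ℕ.+-monoʳ-≤ (2 ℕ.+ k) (Unique⇒length≤ (faces-unique grown)) ⟩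
      2 ℕ.+ k ℕ.+ nFace                              ∎)
    where
    open ℕ.≤-Reasoning
    open Cut C
    k : ℕ
    k = length faces
    0<2g : 0 ℕ.< 2 ℕ.* genus
    0<2g = ℕ.*-mono-≤ (s≤s (ℕ.z≤n {1})) genus-pos
    V≥ : 2 ℕ.+ k ≤ nBlack ℕ.+ nWhite
    V≥ = subst (λ m → suc m ≤ nBlack ℕ.+ nWhite)
      (ℕ.*-cancelʳ-≡ (length vs) (suc k) 2 (trans (sym len) (length-word grown)))
      (Unique-vertices⇒length≤ uvs)
    4E : k ℕ.* 4 ≡ 2 ℕ.* (k ℕ.+ k)
    4E = trans (ℕ.*-comm k 4) (trans (ℕ.*-assoc 2 2 k) (cong (λ m → 2 ℕ.* (k ℕ.+ m)) (ℕ.+-identityʳ k)))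
    E≤ : nEdge ≤ k ℕ.+ k
    E≤ = ℕ.*-cancelˡ-≤ 2 (begin
      2 ℕ.* nEdge                 ≡⟨ cong (nEdge ℕ.+_) (ℕ.+-identityʳ nEdge) ⟩
      nEdge ℕ.+ nEdge             ≤⟨ 2nEdge≤nDart ⟩
      nDart                       ≤⟨ full⇒≤length (λ d → covers grown (full d)) ⟩
      length (word ++ interior)   ≡⟨ length-darts grown ⟩
      k ℕ.* 4                     ≡⟨ 4E ⟩
      2 ℕ.* (k ℕ.+ k)             ∎)

  -- Holonomy of connections with values in a group.

  module Holonomy {g ℓ} (G : Group g ℓ) where
    open Group G renaming (Carrier to ∣G∣; refl to ≈-refl; sym to ≈-sym; trans to ≈-trans)
    open import Algebra.Properties.Group G
    open import Relation.Binary.Reasoning.Setoid (Group.setoid G)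

    hol : (Dart → ∣G∣) → List Dart → ∣G∣
    hol h [] = ε
    hol h (x ∷ L) = h x ∙ hol h L

    Flat : (Dart → ∣G∣) → Dart → Set ℓ
    Flat h x = hol h (tile x) ≈ ε

    Connection : (Dart → ∣G∣) → Set ℓ
    Connection h = ∀ x → h (α x) ≈ h x ⁻¹

    hol-++ : ∀ h K {L} → hol h (K ++ L) ≈ hol h K ∙ hol h L
    hol-++ h [] = ≈-sym (identityˡ _)
    hol-++ h (x ∷ K) = ≈-trans (∙-congˡ (hol-++ h K)) (≈-sym (assoc _ _ _))

    hol-cong : ∀ {h h′} L → (∀ {x} → x ∈ L → h x ≈ h′ x) → hol h L ≈ hol h′ L
    hol-cong [] eq = ≈-refl
    hol-cong (x ∷ L) eq = ∙-cong (eq (here refl)) (hol-cong L (eq ∘ there))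

    -- The first factor and the product of the rest are mutually inverse, so they may be multiplied
    -- in either order.
    Flat-φ : ∀ h x → Flat h x → Flat h (φ x)
    Flat-φ h x flat = begin
      hol h (K ++ φ (φ (φ (φ x))) ∷ [])  ≡⟨ cong (λ y → hol h (K ++ y ∷ [])) (quadrilateral x) ⟩
      hol h (K ++ x ∷ [])                ≈⟨ hol-++ h K {x ∷ []} ⟩
      hol h K ∙ (h x ∙ ε)                ≈⟨ ∙-cong (inverseʳ-unique _ _ flat) (identityʳ _) ⟩
      h x ⁻¹ ∙ h x                       ≈⟨ inverseˡ _ ⟩
      ε                                  ∎
      where
      K : List Dart
      K = φ x ∷ φ (φ x) ∷ φ (φ (φ x)) ∷ []

    Flat-face : ∀ h {x y} → face y ≡ face x → Flat h x → Flat h y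
    Flat-face h {x} eq flat with face⇒∈tile eq
    ... | here refl = flat
    ... | there (here refl) = Flat-φ h x flat
    ... | there (there (here refl)) = Flat-φ h _ (Flat-φ h x flat)
    ... | there (there (there (here refl))) = Flat-φ h _ (Flat-φ h _ (Flat-φ h x flat))

    -- On a flat tile the three other sides multiply to the inverse of `h (α x)`, which is `h x` for
    -- a connection.
    hol-absorb : ∀ h A x B → Connection h → Flat h (α x) →
      hol h (A ++ x ∷ B) ≈ hol h (A ++ φ (α x) ∷ φ (φ (α x)) ∷ φ (φ (φ (α x))) ∷ B)
    hol-absorb h A x B conn flat = ≈-trans (hol-++ h A)
      (≈-trans (∙-congˡ (begin
        h x ∙ hol h B        ≈⟨ ∙-congʳ (≈-sym (⁻¹-involutive (h x))) ⟩
        (h x ⁻¹) ⁻¹ ∙ hol h B  ≈⟨ ∙-congʳ (⁻¹-cong (conn x)) ⟨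
        h (α x) ⁻¹ ∙ hol h B ≈⟨ ∙-congʳ (inverseʳ-unique _ _ flat) ⟨
        hol h K ∙ hol h B    ≈⟨ hol-++ h K {B} ⟨
        hol h (K ++ B)       ∎))
      (≈-sym (hol-++ h A)))
      where
      K : List Dart
      K = φ (α x) ∷ φ (φ (α x)) ∷ φ (φ (φ (α x))) ∷ []

    -- The face of `x₀` is in `Fs` from the start, so every glued tile is another one and hence
    -- flat.
    hol-grown : ∀ {x₀ Fs L D} h → Connection h → (∀ x → face x ≢ face x₀ → Flat h x) →
      Grown x₀ Fs L D → hol h (tile x₀) ≈ hol h L
    hol-grown h conn flat start = ≈-refl
    hol-grown {x₀} h conn flat (absorb {Fs} A x B gr f∉) =
      ≈-trans (hol-grown h conn flat gr) (hol-absorb h A x B conn (flat (α x)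
        λ eq → f∉ (subst (_∈ Fs) (sym eq) (x₀-face gr))))

    -- The incidence theorem with connections in place of realizations and flat tiles in place of
    -- coherent ones.
    HolonomyTheorem : Set _
    HolonomyTheorem = ∀ h → Connection h → ∀ f₀ → (∀ x → face x ≢ f₀ → Flat h x) →
      ∀ x → face x ≡ f₀ → Flat h x

    -- Holonomy in a commutative group.

    module _ (comm : ∀ x y → x ∙ y ≈ y ∙ x) where

      -- Commutativity carries `α x` across `K` to `x`, where the two values cancel; the remaining
      -- word is shorter and again closed under `α`.
      hol-closed : ∀ h → Connection h → ∀ n {L} → length L ≤ n → Unique L → Closed L → hol h L ≈ ε
      hol-closed h conn n {[]} _ _ _ = ≈-refl
      hol-closed h conn (suc n) {x ∷ L} (s≤s len) u cl with cl (here refl)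
      ... | here eq = ⊥-elim (α-free x eq)
      ... | there αx∈ with ∈-∃++ αx∈
      ... | K , M , refl = begin
        h x ∙ hol h (K ++ α x ∷ M)           ≈⟨ ∙-congˡ (hol-++ h K) ⟩
        h x ∙ (hol h K ∙ (h (α x) ∙ hol h M)) ≈⟨ ∙-congˡ (assoc _ _ _) ⟨
        h x ∙ ((hol h K ∙ h (α x)) ∙ hol h M) ≈⟨ ∙-congˡ (∙-congʳ (comm _ _)) ⟩
        h x ∙ ((h (α x) ∙ hol h K) ∙ hol h M) ≈⟨ ∙-congˡ (assoc _ _ _) ⟩
        h x ∙ (h (α x) ∙ (hol h K ∙ hol h M)) ≈⟨ assoc _ _ _ ⟨
        (h x ∙ h (α x)) ∙ (hol h K ∙ hol h M) ≈⟨ ∙-cong (≈-trans (∙-congˡ (conn x)) (inverseʳ (h x))) (≈-sym (hol-++ h K)) ⟩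
        ε ∙ hol h (K ++ M)                    ≈⟨ identityˡ _ ⟩
        hol h (K ++ M)                        ≈⟨ hol-closed h conn n (ℕ.≤-trans (Sub.length-mono-≤ KM⊆) len)
                                                   (Unique-⊆ KM⊆ (Unique-tail u)) closed ⟩
        ε                                     ∎
        where
        KM⊆ : K ++ M ⊆ K ++ α x ∷ M
        KM⊆ = Sub.++⁺ ⊆-refl (α x ∷ʳ ⊆-refl)
        u′ : Unique (x ∷ α x ∷ K ++ M)
        u′ = Unique-resp-↭ (prep x (shift (α x) K M)) u
        closed : Closed (K ++ M)
        closed {d} d∈ with ∈-resp-↭ (prep x (shift (α x) K M)) (cl (there (Sub.Any-resp-⊆ KM⊆ d∈)))
        ... | there (there αd∈) = αd∈
        ... | here eq = ⊥-elim (Unique-head (Unique-tail u′)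
                (subst (_∈ K ++ M) (trans (sym (α-invol d)) (cong α eq)) d∈))
        ... | there (here eq) = ⊥-elim (Unique-head u′ (there
                (subst (_∈ K ++ M) (trans (sym (α-invol d)) (trans (cong α eq) (α-invol x))) d∈)))

      commutative⇒holonomy : HolonomyTheorem
      commutative⇒holonomy h conn _ flat x refl = ≈-trans (hol-grown h conn flat grown)
        (hol-closed h conn _ ℕ.≤-refl (Unique-++ˡ word (darts-unique grown)) closed)
        where open Cut (cut x)

    -- Prescribing values on edges, and the converse.

    set : Dart → ∣G∣ → (Dart → ∣G∣) → Dart → ∣G∣
    set x a h y with y ≟ x | y ≟ α x
    ... | yes _ | _     = a
    ... | no _  | yes _ = a ⁻¹
    ... | no _  | no _  = h y

    set-at : ∀ x a h → set x a h x ≈ a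
    set-at x a h with x ≟ x | x ≟ α x
    ... | yes _ | _ = ≈-refl
    ... | no x≢x | _ = contradiction refl x≢x

    set-α : ∀ x a h → set x a h (α x) ≈ a ⁻¹
    set-α x a h with α x ≟ x | α x ≟ α x
    ... | yes eq | _     = contradiction eq (α-free x)
    ... | no _   | yes _ = ≈-refl
    ... | no _   | no αx≢ = contradiction refl αx≢

    set-off : ∀ x a h {y} → y ≢ x → y ≢ α x → set x a h y ≈ h y
    set-off x a h {y} y≢x y≢αx with y ≟ x | y ≟ α x
    ... | yes eq | _      = contradiction eq y≢x
    ... | no _   | yes eq = contradiction eq y≢αx
    ... | no _   | no _   = ≈-refl

    set-connection : ∀ x a {h} → Connection h → Connection (set x a h)
    set-connection x a {h} conn y with y ≟ x | y ≟ α x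
    ... | yes refl | _        = set-α x a h
    ... | no _     | yes refl = ≈-trans (≈-trans (reflexive (cong (set x a h) (α-invol x))) (set-at x a h))
                                  (≈-sym (⁻¹-involutive a))
    ... | no y≢x   | no y≢αx  = ≈-trans (set-off x a h
        (λ eq → y≢αx (trans (sym (α-invol y)) (cong α eq)))
        (λ eq → y≢x (trans (sym (α-invol y)) (trans (cong α eq) (α-invol x)))))
        (conn y)

    -- In the inductive step the connection is corrected on the edge of x so as to become flat on
    -- the tile of α x.
    holonomy-grown : ∀ {x₀ Fs L D} → HolonomyTheorem → Grown x₀ Fs L D →
      ∀ h → Connection h → (∀ y → face y ∉ Fs → Flat h y) → hol h L ≈ ε
    holonomy-grown {x₀} thm start h conn flat =
      thm h conn (face x₀) (λ y f≢ → flat y λ { (here eq) → f≢ eq }) x₀ refl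
    holonomy-grown {x₀} thm (absorb {Fs} {D} A x B gr f∉) h conn flat = begin
      hol h (A ++ K ++ B)   ≈⟨ hol-cong (A ++ K ++ B) (λ y∈ → ≈-sym (off (≢x y∈) (≢αx y∈))) ⟩
      hol h′ (A ++ K ++ B)  ≈⟨ hol-absorb h′ A x B conn′ flat-αx ⟨
      hol h′ (A ++ x ∷ B)   ≈⟨ holonomy-grown thm gr h′ conn′ flat′ ⟩
      ε                     ∎
      where
      K : List Dart
      K = φ (α x) ∷ φ (φ (α x)) ∷ φ (φ (φ (α x))) ∷ []
      h′ : Dart → ∣G∣
      -- With this value on `x`, the factor on `α x` is inverse to the product of the other three
      -- sides of its tile.
      h′ = set x (hol h K) h
      conn′ : Connection h′
      conn′ = set-connection x _ conn
      off : ∀ {y} → y ≢ x → y ≢ α x → h′ y ≈ h y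
      off = set-off x _ h
      u : Unique ((A ++ K ++ B) ++ x ∷ α x ∷ D)
      u = darts-unique (absorb A x B gr f∉)
      ≢x : ∀ {y} → y ∈ A ++ K ++ B → y ≢ x
      ≢x y∈ eq = Unique-disjoint (A ++ K ++ B) u y∈ (here eq)
      ≢αx : ∀ {y} → y ∈ A ++ K ++ B → y ≢ α x
      ≢αx y∈ eq = Unique-disjoint (A ++ K ++ B) u y∈ (there (here eq))
      K∈ : ∀ {y} → y ∈ K → y ∈ A ++ K ++ B
      K∈ y∈ = ∈-++⁺ʳ A (∈-++⁺ˡ y∈)
      x∈Fs : face x ∈ Fs
      x∈Fs = covered gr (∈-++⁺ˡ (∈-insert A))
      flat-αx : Flat h′ (α x)
      flat-αx = ≈-trans
        (∙-cong (set-α x _ h) (hol-cong K (λ y∈ → off (≢x (K∈ y∈)) (≢αx (K∈ y∈)))))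
        (inverseˡ _)
      -- A tile outside `Fs` other than that of `α x` contains neither dart of the corrected edge,
      -- so it stays flat.
      flat′ : ∀ y → face y ∉ Fs → Flat h′ y
      flat′ y y∉ with face y ≟ face (α x)
      ... | yes eq = Flat-face h′ eq flat-αx
      ... | no neq = ≈-trans (hol-cong (tile y) λ z∈ → off
              (λ { refl → y∉ (subst (_∈ Fs) (∈tile⇒face z∈) x∈Fs) })
              (λ { refl → neq (sym (∈tile⇒face z∈)) }))
            (flat y λ { (here eq) → neq eq ; (there f∈) → y∉ f∈ })

    -- A dropped letter contributes `ε`: by uniqueness of `L` it does not recur among the letters
    -- kept in `K`.
    hol-⊆ : ∀ {K L} h → K ⊆ L → Unique L → (∀ {x} → x ∈ L → x ∉ K → h x ≈ ε) → hol h K ≈ hol h L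
    hol-⊆ h [] u trivial = ≈-refl
    hol-⊆ h (y ∷ʳ p) u trivial = ≈-trans (hol-⊆ h p (Unique-tail u) (trivial ∘ there))
      (≈-sym (≈-trans (∙-congʳ (trivial (here refl) (Unique-head u ∘ Sub.Any-resp-⊆ p))) (identityˡ _)))
    hol-⊆ h (refl ∷ p) u trivial = ∙-congˡ (hol-⊆ h p (Unique-tail u) λ x∈ x∉ → trivial (there x∈)
      λ { (here refl) → Unique-head u x∈ ; (there x∈K) → x∉ x∈K })

    -- The hypothesis is the holonomy of an interlacing pair of edges, bracketed as `hol` produces
    -- it.
    commutator : ∀ {a b} → a ∙ (b ∙ (a ⁻¹ ∙ (b ⁻¹ ∙ ε))) ≈ ε → a ∙ b ≈ b ∙ a
    commutator {a} {b} eq = x∙y⁻¹≈ε⇒x≈y _ _ (begin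
      (a ∙ b) ∙ (b ∙ a) ⁻¹           ≈⟨ ∙-congˡ (⁻¹-anti-homo-∙ b a) ⟩
      (a ∙ b) ∙ (a ⁻¹ ∙ b ⁻¹)        ≈⟨ assoc _ _ _ ⟩
      a ∙ (b ∙ (a ⁻¹ ∙ b ⁻¹))        ≈⟨ ∙-congˡ (∙-congˡ (∙-congˡ (identityʳ _))) ⟨
      a ∙ (b ∙ (a ⁻¹ ∙ (b ⁻¹ ∙ ε)))  ≈⟨ eq ⟩
      ε                              ∎)

    holonomy⇒commutative : HolonomyTheorem → ∀ a b → a ∙ b ≈ b ∙ a
    holonomy⇒commutative thm a b = from-cut (cut dart₀)
      where
      from-cut : ∀ {x₀} → Cut x₀ → a ∙ b ≈ b ∙ a
      from-cut C with Dyck⊎Crossing (Unique-++ˡ _ (darts-unique (Cut.grown C))) (Cut.closed C)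
      ... | inj₁ dyck = ⊥-elim (¬Dyck-cut C dyck)
      ... | inj₂ (x , y , cr) = commutator (begin
          a ∙ (b ∙ (a ⁻¹ ∙ (b ⁻¹ ∙ ε)))
            ≈⟨ ∙-cong (set-at x a h₁) (∙-cong h-y (∙-cong (set-α x a h₁) (∙-congʳ h-αy))) ⟨
          hol h (x ∷ y ∷ α x ∷ α y ∷ [])
            ≈⟨ hol-⊆ h cr uL (λ _ z∉ → ≈-trans
                 (set-off x a h₁ (z∉ ∘ here) (z∉ ∘ there ∘ there ∘ here))
                 (set-off y b _ (z∉ ∘ there ∘ here) (z∉ ∘ there ∘ there ∘ there ∘ here))) ⟩
          hol h word
            ≈⟨ holonomy-grown thm grown h (set-connection x a (set-connection y b λ _ → ≈-sym ε⁻¹≈ε))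
                 -- The cut contains every tile, so no tile remains outside on which flatness would
                 -- have to be shown.
                 (λ z z∉ → ⊥-elim (z∉ (full z))) ⟩
          ε ∎)
        where
        open Cut C
        h₁ h : Dart → ∣G∣
        h₁ = set y b (λ _ → ε)
        h = set x a h₁
        uL : Unique word
        uL = Unique-++ˡ word (darts-unique grown)
        u : Unique (x ∷ y ∷ α x ∷ α y ∷ [])
        u = Unique-⊆ cr uL
        h-y : h y ≈ b
        h-y = ≈-trans (set-off x a h₁ (λ { refl → Unique-head u (here refl) })
          (λ eq → Unique-head (Unique-tail u) (here eq))) (set-at y b _)
        h-αy : h (α y) ≈ b ⁻¹
        h-αy = ≈-trans (set-off x a h₁ (λ eq → Unique-head u (there (there (here (sym eq)))))
          (λ eq → Unique-head (Unique-tail (Unique-tail u)) (here (sym eq)))) (set-α y b _)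

-- The group of units of a ring.

module Units {c ℓ} (R : Ring c ℓ) where
  open Ring R
  open SetoidReasoning setoid

  Unit : Set (c ⊔ ℓ)
  Unit = Σ Carrier (IsUnit R)

  left-inverse-unique : ∀ {u w w′} → w * u ≈ 1# → u * w′ ≈ 1# → w ≈ w′
  left-inverse-unique {u} {w} {w′} wu uw′ = begin
    w             ≈⟨ *-identityʳ w ⟨
    w * 1#        ≈⟨ *-congˡ uw′ ⟨
    w * (u * w′)  ≈⟨ *-assoc w u w′ ⟨
    (w * u) * w′  ≈⟨ *-congʳ wu ⟩
    1# * w′       ≈⟨ *-identityˡ w′ ⟩
    w′            ∎

  *-inverse : ∀ {u w u′ w′} → u * w ≈ 1# → u′ * w′ ≈ 1# → (u * u′) * (w′ * w) ≈ 1#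
  *-inverse {u} {w} {u′} {w′} uw u′w′ = begin
    (u * u′) * (w′ * w)  ≈⟨ *-assoc u u′ (w′ * w) ⟩
    u * (u′ * (w′ * w))  ≈⟨ *-congˡ (*-assoc u′ w′ w) ⟨
    u * ((u′ * w′) * w)  ≈⟨ *-congˡ (*-congʳ u′w′) ⟩
    u * (1# * w)         ≈⟨ *-congˡ (*-identityˡ w) ⟩
    u * w                ≈⟨ uw ⟩
    1#                   ∎

  units : Group (c ⊔ ℓ) ℓ
  units = record
    { Carrier = Unit
    ; _≈_ = λ u v → proj₁ u ≈ proj₁ v
    ; _∙_ = λ (u , w , uw , wu) (u′ , w′ , uw′ , wu′) →
        u * u′ , w′ * w , *-inverse uw uw′ , *-inverse wu′ wu
    ; ε = 1# , 1# , *-identityˡ 1# , *-identityˡ 1#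
    ; _⁻¹ = λ (u , w , uw , wu) → w , u , wu , uw
    ; isGroup = record
      { isMonoid = record
        { isSemigroup = record
          { isMagma = record
            { isEquivalence = record { refl = refl ; sym = sym ; trans = trans }
            ; ∙-cong = *-cong }
          ; assoc = λ _ _ _ → *-assoc _ _ _ }
        ; identity = (λ _ → *-identityˡ _) , (λ _ → *-identityʳ _) }
      ; inverse = (λ (_ , _ , _ , wu) → wu) , (λ (_ , _ , uw , _) → uw)
      -- Equality in the group ignores the stored inverses, so their agreement has to be proved.
      ; ⁻¹-cong = λ {(u , w , uw , wu)} {(u′ , w′ , uw′ , wu′)} eq →
          left-inverse-unique wu (trans (*-congʳ eq) uw′) }
    }

  IsUnit-resp : ∀ {u v} → u ≈ v → IsUnit R u → IsUnit R v
  IsUnit-resp eq (w , uw , wu) = w , trans (*-congʳ (sym eq)) uw , trans (*-congˡ (sym eq)) wu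

-- Linear forms with given kernel, and generators of points.

module Projective {c ℓ} (R : Ring c ℓ) (n : ℕ) where
  open Ring R
  open RingProperties R using
    (x∙y⁻¹≈ε⇒x≈y; x≈y⇒x∙y⁻¹≈ε; xyx⁻¹≈y; [y-z]x≈yx-zx; -1*x≈-x; -‿distribˡ-*)
  open CommutativeSemigroupProperties +-commutativeSemigroup using (interchange)
  open SemiringSum semiring using (sum; sum-cong-≋; sum-remove; sum-replicate-zero;
    ∑-distrib-+; *-distribˡ-sum)
  open SetoidReasoning setoid
  open Units R

  V : Set c
  V = M R n

  Sub : Set (lsuc (c ⊔ ℓ))
  Sub = Submodule R n

  infix 4 _≋_
  infixl 6 _⊕_
  infixr 7 _⊙_

  _≋_ : V → V → Set ℓ
  _≋_ = _≈ᴹ_ R n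

  _⊕_ : V → V → V
  _⊕_ = _+ᴹ_ R n

  _⊙_ : Carrier → V → V
  _⊙_ = _·ᴹ_ R n

  difference : ∀ {p q p′ q′} → p + q ≈ p′ + q′ → p - p′ ≈ q′ - q
  difference {p} {q} {p′} {q′} eq = begin
    p - p′                 ≈⟨ +-congʳ (+-identityʳ p) ⟨
    p + 0# - p′            ≈⟨ +-congʳ (+-congˡ (-‿inverseʳ q)) ⟨
    p + (q - q) - p′       ≈⟨ +-congʳ (+-assoc p q (- q)) ⟨
    (p + q - q) - p′       ≈⟨ +-congʳ (+-congʳ eq) ⟩
    (p′ + q′ - q) - p′     ≈⟨ +-congʳ (+-assoc p′ q′ (- q)) ⟩
    p′ + (q′ - q) - p′     ≈⟨ xyx⁻¹≈y p′ (q′ - q) ⟩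
    q′ - q                 ∎

  record Form (L : Sub) : Set (c ⊔ ℓ) where
    field
      fun : V → Carrier
      fun-cong : ∀ {u v} → u ≋ v → fun u ≈ fun v
      fun-+ : ∀ u v → fun (u ⊕ v) ≈ fun u + fun v
      fun-· : ∀ r v → fun (r ⊙ v) ≈ r * fun v
      kernel : ∀ v → mem L v ⇔ (fun v ≈ 0#)

    fun-combine : ∀ {v} r u s w → v ≋ r ⊙ u ⊕ s ⊙ w → fun v ≈ r * fun u + s * fun w
    fun-combine r u s w eq = trans (fun-cong eq) (trans (fun-+ _ _) (+-cong (fun-· r u) (fun-· s w)))

  open Form

  record Generator (A : Sub) : Set (c ⊔ ℓ) where
    field
      vec : V
      spans : ∀ v → mem A v ⇔ (∃ λ r → v ≋ r ⊙ vec)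
      free : ∀ r → r ⊙ vec ≋ 0ᴹ R n → r ≈ 0#

  open Generator

  generator : ∀ {A} → FreeRankOne R n A → Generator A
  generator (a , spans , free) = record { vec = a ; spans = spans ; free = free }

  module Complement {A L} (a : Generator A) (A⊕L : DirectSum R n A L) where

    Split : V → Carrier → Set (c ⊔ ℓ)
    Split v r = ∃ λ l → mem L l × v ≋ r ⊙ vec a ⊕ l

    split : ∀ v → ∃ (Split v)
    split v with proj₁ A⊕L v
    ... | a′ , l , a′∈A , l∈L , eq with spans a a′ .to a′∈A
    ... | r , eq′ = r , l , l∈L , λ i → trans (eq i) (+-congʳ (eq′ i))

    -- The difference of two decompositions lies in both `A` and `L`, hence vanishes, and freeness
    -- of the generator makes `r - s` zero. Linearity of `coordinate` is read off from this
    -- uniqueness.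
    Split-unique : ∀ {v r s} → Split v r → Split v s → r ≈ s
    Split-unique {v} {r} {s} (l , l∈ , eq) (l′ , l′∈ , eq′) =
      x∙y⁻¹≈ε⇒x≈y r s (free a (r - s) (proj₂ A⊕L _ (spans a _ .from (r - s , λ i → refl))
        (mem-resp L (λ i → sym (diff i)) (mem-+ L l′∈ (mem-· L (- 1#) l∈)))))
      where
      diff : (r - s) ⊙ vec a ≋ l′ ⊕ (- 1#) ⊙ l
      diff i = begin
        (r - s) * vec a i           ≈⟨ [y-z]x≈yx-zx (vec a i) r s ⟩
        r * vec a i - s * vec a i   ≈⟨ difference (trans (sym (eq i)) (eq′ i)) ⟩
        l′ i - l i                  ≈⟨ +-congˡ (-1*x≈-x (l i)) ⟨
        l′ i + (- 1#) * l i         ∎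

    Split-+ : ∀ {u v r s} → Split u r → Split v s → Split (u ⊕ v) (r + s)
    Split-+ (l , l∈ , eq) (l′ , l′∈ , eq′) = l ⊕ l′ , mem-+ L l∈ l′∈ , λ i →
      trans (+-cong (eq i) (eq′ i)) (trans (interchange _ _ _ _) (+-congʳ (sym (distribʳ _ _ _))))

    Split-· : ∀ {v r} t → Split v r → Split (t ⊙ v) (t * r)
    Split-· t (l , l∈ , eq) = t ⊙ l , mem-· L t l∈ , λ i →
      trans (*-congˡ (eq i)) (trans (distribˡ _ _ _) (+-congʳ (sym (*-assoc _ _ _))))

    Split-resp : ∀ {u v r} → u ≋ v → Split u r → Split v r
    Split-resp u≋v (l , l∈ , eq) = l , l∈ , λ i → trans (sym (u≋v i)) (eq i)

    coordinate : Form L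
    coordinate = record
      { fun = λ v → split v .proj₁
      ; fun-cong = λ {u} {v} u≋v → Split-unique (Split-resp u≋v (split u .proj₂)) (split v .proj₂)
      ; fun-+ = λ u v → Split-unique (split (u ⊕ v) .proj₂) (Split-+ (split u .proj₂) (split v .proj₂))
      ; fun-· = λ r v → Split-unique (split (r ⊙ v) .proj₂) (Split-· r (split v .proj₂))
      ; kernel = λ v → mk⇔
          (λ v∈L → Split-unique (split v .proj₂)
            (v , v∈L , λ i → trans (sym (+-identityˡ _)) (+-congʳ (sym (zeroˡ _)))))
          (λ r≈0 → let (l , l∈ , eq) = split v .proj₂ in
            mem-resp L (λ i → sym (trans (eq i)
              (trans (+-congʳ (trans (*-congʳ r≈0) (zeroˡ _))) (+-identityˡ _)))) l∈)
      }

    coordinate-vec : fun coordinate (vec a) ≈ 1#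
    coordinate-vec = Split-unique (split (vec a) .proj₂)
      (0ᴹ R n , mem-0 L , λ i → sym (trans (+-identityʳ _) (*-identityˡ _)))

  -- Writing `e` as `r` times the generator plus an element of `L` gives a left inverse `r` of the
  -- value `x`. It is also a right inverse: `(1# - x * r) ⊙ vec a` is killed by `f`, so it lies in
  -- both summands, and freeness applies.
  form-unit : ∀ {A L} (f : Form L) (a : Generator A) → DirectSum R n A L →
    ∀ {e} → fun f e ≈ 1# → IsUnit R (fun f (vec a))
  form-unit {A} {L} f a A⊕L {e} fe≈1 = r , ar≈1 , ra≈1
    where
    open Complement {A} {L} a A⊕L
    x r : Carrier
    x = fun f (vec a)
    r = split e .proj₁
    left-inverse : ∀ {r} → Split e r → r * x ≈ 1#
    left-inverse {r} (l , l∈ , eq) = begin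
      r * x                         ≈⟨ +-identityʳ _ ⟨
      r * x + 0#                    ≈⟨ +-cong (fun-· f r (vec a)) (kernel f l .to l∈) ⟨
      fun f (r ⊙ vec a) + fun f l   ≈⟨ fun-+ f _ _ ⟨
      fun f (r ⊙ vec a ⊕ l)         ≈⟨ fun-cong f eq ⟨
      fun f e                       ≈⟨ fe≈1 ⟩
      1#                            ∎
    ra≈1 : r * x ≈ 1#
    ra≈1 = left-inverse (split e .proj₂)
    in-L : mem L ((1# - x * r) ⊙ vec a)
    in-L = kernel f _ .from (begin
      fun f ((1# - x * r) ⊙ vec a)  ≈⟨ fun-· f _ _ ⟩
      (1# - x * r) * x              ≈⟨ [y-z]x≈yx-zx x 1# (x * r) ⟩
      1# * x - x * r * x            ≈⟨ +-cong (*-identityˡ x) (-‿cong (*-assoc x r x)) ⟩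
      x - x * (r * x)               ≈⟨ +-congˡ (-‿cong (*-congˡ ra≈1)) ⟩
      x - x * 1#                    ≈⟨ +-congˡ (-‿cong (*-identityʳ x)) ⟩
      x - x                         ≈⟨ -‿inverseʳ x ⟩
      0#                            ∎)
    ar≈1 : x * r ≈ 1#
    ar≈1 = sym (x∙y⁻¹≈ε⇒x≈y 1# (x * r)
      (free a _ (proj₂ A⊕L _ (spans a _ .from (_ , λ i → refl)) in-L)))

  -- Coherence in terms of values of forms.

  open Group units using (_∙_; _⁻¹) renaming (_≈_ to _≈ᵘ_)

  module _ {A₁ A₂ : Sub} (a₁ : Generator A₁) (a₂ : Generator A₂) where

    private
      -- If `v` has coefficients `r` and `s` on the two generators, each form takes on `v` the value
      -- `r * t + s` times its value on `vec a₂`. The latter is a unit for `f₁`, so vanishing under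
      -- `f₁` forces `r * t + s` to vanish.
      transfer : ∀ {L₁ L₂} (f₁ : Form L₁) (f₂ : Form L₂) t →
        fun f₁ (vec a₁) ≈ t * fun f₁ (vec a₂) → fun f₂ (vec a₁) ≈ t * fun f₂ (vec a₂) →
        IsUnit R (fun f₁ (vec a₂)) →
        ∀ v → InSum R n A₁ A₂ v × mem L₁ v → InSum R n A₁ A₂ v × mem L₂ v
      transfer f₁ f₂ t eq₁ eq₂ (w , yw , wy) v (v∈A@(b₁ , b₂ , b₁∈ , b₂∈ , eq) , v∈L)
        with spans a₁ b₁ .to b₁∈ | spans a₂ b₂ .to b₂∈
      ... | r , p | s , q = v∈A , kernel f₂ v .from (begin
          fun f₂ v                                 ≈⟨ value f₂ eq₂ ⟩
          (r * t + s) * fun f₂ (vec a₂)            ≈⟨ *-congʳ rt+s≈0 ⟩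
          0# * fun f₂ (vec a₂)                     ≈⟨ zeroˡ _ ⟩
          0#                                       ∎)
        where
        value : ∀ {L} (f : Form L) → fun f (vec a₁) ≈ t * fun f (vec a₂) →
          fun f v ≈ (r * t + s) * fun f (vec a₂)
        value f eq′ = begin
          fun f v                                        ≈⟨ fun-combine f r (vec a₁) s (vec a₂)
                                                              (λ i → trans (eq i) (+-cong (p i) (q i))) ⟩
          r * fun f (vec a₁) + s * fun f (vec a₂)        ≈⟨ +-congʳ (*-congˡ eq′) ⟩
          r * (t * fun f (vec a₂)) + s * fun f (vec a₂)  ≈⟨ +-congʳ (*-assoc r t _) ⟨
          r * t * fun f (vec a₂) + s * fun f (vec a₂)    ≈⟨ distribʳ _ _ _ ⟨
          (r * t + s) * fun f (vec a₂)                   ∎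
        rt+s≈0 : r * t + s ≈ 0#
        rt+s≈0 = begin
          r * t + s                               ≈⟨ *-identityʳ _ ⟨
          (r * t + s) * 1#                        ≈⟨ *-congˡ yw ⟨
          (r * t + s) * (fun f₁ (vec a₂) * w)     ≈⟨ *-assoc _ _ _ ⟨
          (r * t + s) * fun f₁ (vec a₂) * w       ≈⟨ *-congʳ (value f₁ eq₁) ⟨
          fun f₁ v * w                            ≈⟨ *-congʳ (kernel f₁ v .to v∈L) ⟩
          0# * w                                  ≈⟨ zeroˡ w ⟩
          0#                                      ∎

    module _ {L₁ L₂ : Sub} (f₁ : Form L₁) (f₂ : Form L₂) (u₁₁ u₁₂ u₂₁ u₂₂ : Unit)
      (e₁₁ : proj₁ u₁₁ ≈ fun f₁ (vec a₁)) (e₁₂ : proj₁ u₁₂ ≈ fun f₂ (vec a₁))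
      (e₂₁ : proj₁ u₂₁ ≈ fun f₁ (vec a₂)) (e₂₂ : proj₁ u₂₂ ≈ fun f₂ (vec a₂)) where

      -- (A₁ + A₂) ∩ L₁ is generated by a₁ - t a₂, where t = f₁(a₁) f₁(a₂)⁻¹.
      coherent⇔ratio : Coherent R n A₁ A₂ L₁ L₂ ⇔ (u₁₁ ∙ u₂₁ ⁻¹ ≈ᵘ u₁₂ ∙ u₂₂ ⁻¹)
      coherent⇔ratio = mk⇔ ratio coherent
        where
        open GroupProperties units using (//-rightDividesˡ; //-rightDividesʳ)
        divide : ∀ (u v t : Unit) → t ≈ᵘ u ∙ v ⁻¹ → ∀ {x y} → proj₁ u ≈ x → proj₁ v ≈ y →
          x ≈ proj₁ t * y
        divide u v t eq ux vy =
          trans (sym ux) (trans (sym (//-rightDividesˡ v u)) (*-cong (sym eq) vy))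
        t : Unit
        t = u₁₁ ∙ u₂₁ ⁻¹
        ratio : Coherent R n A₁ A₂ L₁ L₂ → t ≈ᵘ u₁₂ ∙ u₂₂ ⁻¹
        ratio coh = begin
          proj₁ t                                   ≈⟨ //-rightDividesʳ u₂₂ t ⟨
          proj₁ (t ∙ u₂₂ ∙ u₂₂ ⁻¹)                  ≈⟨ *-congʳ (trans (*-congˡ e₂₂) (trans (sym f₂-eq) (sym e₁₂))) ⟩
          proj₁ (u₁₂ ∙ u₂₂ ⁻¹)                      ∎
          where
          v : V
          v = 1# ⊙ vec a₁ ⊕ (- proj₁ t) ⊙ vec a₂
          value : ∀ {L} (f : Form L) → fun f v ≈ fun f (vec a₁) - proj₁ t * fun f (vec a₂)
          value f = trans (fun-combine f _ _ _ _ (λ i → refl))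
            (+-cong (*-identityˡ _) (sym (-‿distribˡ-* _ _)))
          v∈L₂ : mem L₂ v
          v∈L₂ = coh v .to
            ( (_ , _ , spans a₁ _ .from (_ , λ i → refl) , spans a₂ _ .from (_ , λ i → refl) , λ i → refl)
            , kernel f₁ v .from (trans (value f₁) (x≈y⇒x∙y⁻¹≈ε (divide u₁₁ u₂₁ t refl e₁₁ e₂₁)))) .proj₂
          f₂-eq : fun f₂ (vec a₁) ≈ proj₁ t * fun f₂ (vec a₂)
          f₂-eq = x∙y⁻¹≈ε⇒x≈y _ _ (trans (sym (value f₂)) (kernel f₂ v .to v∈L₂))
        coherent : t ≈ᵘ u₁₂ ∙ u₂₂ ⁻¹ → Coherent R n A₁ A₂ L₁ L₂
        coherent eq v = mk⇔ (transfer f₁ f₂ (proj₁ t) eq₁ eq₂ (IsUnit-resp e₂₁ (proj₂ u₂₁)) v)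
                            (transfer f₂ f₁ (proj₁ t) eq₂ eq₁ (IsUnit-resp e₂₂ (proj₂ u₂₂)) v)
          where
          eq₁ : fun f₁ (vec a₁) ≈ proj₁ t * fun f₁ (vec a₂)
          eq₁ = divide u₁₁ u₂₁ t refl e₁₁ e₂₁
          eq₂ : fun f₂ (vec a₁) ≈ proj₁ t * fun f₂ (vec a₂)
          eq₂ = divide u₁₂ u₂₂ t eq e₁₂ e₂₂

  -- From realizations to connections.

  module _ (T : QuadTiling) where
    open QuadTiling T
    open Tiling T
    open Holonomy units
    open Realization

    -- Keeps the choice of forms and generators apart from the realization, so that `tile⇔flat`
    -- serves both an arbitrary realization and one built from a given connection.
    record Framing (ρ : Realization R n T) (h : Dart → Unit) : Set (c ⊔ ℓ) where
      field
        form : ∀ w → Form (hp ρ w)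
        gen : ∀ b → Generator (pt ρ b)
        connection : Connection h
        value : ∀ x {b w} → vertex x ≡ inj₁ b → vertex (α x) ≡ inj₂ w →
          proj₁ (h x) ≈ fun (form w) (vec (gen b))

    white-after : ∀ x {b} → vertex x ≡ inj₁ b → ∃ λ w → vertex (φ x) ≡ inj₂ w
    white-after x eq with vertex x | vertex (α x) in eq′ | bipartite x
    white-after x ≡.refl | inj₁ _ | inj₂ w | _ = w , ≡.trans (vertex-σ (α x)) eq′

    black-after : ∀ x {w} → vertex x ≡ inj₂ w → ∃ λ b → vertex (φ x) ≡ inj₁ b
    black-after x eq with vertex x | vertex (α x) in eq′ | bipartite x
    black-after x ≡.refl | inj₂ _ | inj₁ b | _ = b , ≡.trans (vertex-σ (α x)) eq′

    module _ {ρ : Realization R n T} {h : Dart → Unit} (F : Framing ρ h) where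
      open Framing F

      -- Read around the tile, the holonomy is `u₁₁ ∙ u₂₁ ⁻¹` times `u₂₂ ∙ u₁₂ ⁻¹`, and the second
      -- factor is the inverse of `u₁₂ ∙ u₂₂ ⁻¹`.
      flat⇔ratio : ∀ {u₁₁ u₁₂ u₂₁ u₂₂ : Unit} x → h x ≈ᵘ u₁₁ → h (φ x) ≈ᵘ u₂₁ ⁻¹ →
        h (φ (φ x)) ≈ᵘ u₂₂ → h (φ (φ (φ x))) ≈ᵘ u₁₂ ⁻¹ →
        Flat h x ⇔ (u₁₁ ∙ u₂₁ ⁻¹ ≈ᵘ u₁₂ ∙ u₂₂ ⁻¹)
      flat⇔ratio {u₁₁} {u₁₂} {u₂₁} {u₂₂} x e₀ e₁ e₂ e₃ = mk⇔
        (λ flat → U.x∙y⁻¹≈ε⇒x≈y (u₁₁ ∙ u₂₁ ⁻¹) (u₁₂ ∙ u₂₂ ⁻¹) (trans (sym rearrange) flat))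
        (λ eq → trans rearrange (U.x≈y⇒x∙y⁻¹≈ε {u₁₁ ∙ u₂₁ ⁻¹} {u₁₂ ∙ u₂₂ ⁻¹} eq))
        where
        module U = GroupProperties units
        rearrange : hol h (tile x) ≈ᵘ (u₁₁ ∙ u₂₁ ⁻¹) ∙ (u₁₂ ∙ u₂₂ ⁻¹) ⁻¹
        rearrange = trans
          (*-cong e₀ (*-cong e₁ (*-cong e₂ (trans (*-identityʳ _) e₃))))
          (sym (*-assoc _ _ _))

      coherent⇔flat : ∀ x {b₁ b₂ w₁ w₂} →
        vertex x ≡ inj₁ b₁ → vertex (φ x) ≡ inj₂ w₁ →
        vertex (φ (φ x)) ≡ inj₁ b₂ → vertex (φ (φ (φ x))) ≡ inj₂ w₂ →
        Coherent R n (pt ρ b₁) (pt ρ b₂) (hp ρ w₁) (hp ρ w₂) ⇔ Flat h x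
      coherent⇔flat x {b₁} {b₂} {w₁} {w₂} v₀ v₁ v₂ v₃ = mk⇔ (flat .from ∘ ratio .to) (ratio .from ∘ flat .to)
        where
        x₁ x₂ x₃ : Dart
        x₁ = φ x
        x₂ = φ x₁
        x₃ = φ x₂
        -- `value` speaks of darts from black to white, so the two other sides of the tile are
        -- traded for their opposites.
        reverse : ∀ y → h y ≈ᵘ h (α y) ⁻¹
        reverse y = trans (reflexive (≡.cong (proj₁ ∘ h) (≡.sym (α-invol y)))) (connection (α y))
        head : ∀ y {v} → vertex (φ y) ≡ v → vertex (α y) ≡ v
        head y eq = ≡.trans (≡.sym (vertex-σ (α y))) eq
        tail : ∀ y {v} → vertex y ≡ v → vertex (α (α y)) ≡ v
        tail y eq = ≡.trans (≡.cong vertex (α-invol y)) eq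
        ratio : Coherent R n (pt ρ b₁) (pt ρ b₂) (hp ρ w₁) (hp ρ w₂) ⇔
                (h x ∙ h (α x₁) ⁻¹ ≈ᵘ h (α x₃) ∙ h x₂ ⁻¹)
        ratio = coherent⇔ratio (gen b₁) (gen b₂) (form w₁) (form w₂) (h x) (h (α x₃)) (h (α x₁)) (h x₂)
          (value x v₀ (head x v₁))
          (value (α x₃) (head x₃ (≡.trans (≡.cong vertex (quadrilateral x)) v₀)) (tail x₃ v₃))
          (value (α x₁) (head x₁ v₂) (tail x₁ v₁))
          (value x₂ v₂ (head x₂ v₃))
        flat : Flat h x ⇔ (h x ∙ h (α x₁) ⁻¹ ≈ᵘ h (α x₃) ∙ h x₂ ⁻¹)
        flat = flat⇔ratio {h x} {h (α x₃)} {h (α x₁)} {h x₂} x refl (reverse x₁) refl (reverse x₃)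

      TileAt : Dart → Set (c ⊔ ℓ)
      TileAt x = TileCond R n (pt ρ) (hp ρ)
        (vertex x) (vertex (φ x)) (vertex (φ (φ x))) (vertex (φ (φ (φ x))))

      tile⇔flat : ∀ x → TileAt x ⇔ Flat h x
      tile⇔flat x with vertex x in v₀
      ... | inj₁ b₁ with white-after x v₀
      ...   | w₁ , v₁ with black-after (φ x) v₁
      ...     | b₂ , v₂ with white-after (φ (φ x)) v₂
      ...       | w₂ , v₃ rewrite v₁ | v₂ | v₃ = coherent⇔flat x v₀ v₁ v₂ v₃
      tile⇔flat x | inj₂ w₁ with black-after x v₀
      ...   | b₁ , v₁ with white-after (φ x) v₁
      ...     | w₂ , v₂ with black-after (φ (φ x)) v₂
      ...       | b₂ , v₃ rewrite v₁ | v₂ | v₃ = mk⇔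
        (λ coh → Flat-face h (≡.sym (face-φ x)) (rotated .to λ v → mk⇔ (coh v .from) (coh v .to)))
        (λ flat v → let coh = rotated .from (Flat-face h (face-φ x) flat) in
          mk⇔ (coh v .from) (coh v .to))
        where
        -- Starting at the next dart, which is black, interchanges the two hyperplanes; coherence is
        -- symmetric in them.
        rotated : Coherent R n (pt ρ b₁) (pt ρ b₂) (hp ρ w₂) (hp ρ w₁) ⇔ Flat h (φ x)
        rotated = coherent⇔flat (φ x) v₁ v₂ v₃ (≡.trans (≡.cong vertex (quadrilateral x)) v₀)

    module _ (ρ : Realization R n T) where

      gens : ∀ b → Generator (pt ρ b)
      gens b = generator (proj₁ (pt-point ρ b))

      -- The coordinate along a complementary point is a form whose kernel is the hyperplane. The
      -- vector of value `1#` is kept for `form-unit`.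
      forms : ∀ w → Σ (Form (hp ρ w)) λ f → ∃ λ e → fun f e ≈ 1#
      forms w with hp-hyperplane ρ w
      ... | A , (A-free , _) , A⊕L = coordinate , vec a , coordinate-vec
        where
        a : Generator A
        a = generator A-free
        open Complement {A} {hp ρ w} a A⊕L

      edge-value : ∀ {b w} → NonNeighboring R n (pt ρ b) (hp ρ w) → Unit
      edge-value {b} {w} A⊕L = _ , form-unit (forms w .proj₁) (gens b) A⊕L (forms w .proj₂ .proj₂)

      dart-value : ∀ v v′ → EdgeCond R n (pt ρ) (hp ρ) v v′ → Bip v v′ → Unit
      dart-value (inj₁ b) (inj₂ w) e _ = edge-value e
      dart-value (inj₂ w) (inj₁ b) e _ = edge-value e ⁻¹

      -- `v″` is the vertex of `α (α x)`, equal to `v` only propositionally. The two edge conditions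
      -- may be different proofs with different stored inverses, which `⁻¹-cong` identifies.
      dart-value-reverse : ∀ v v′ {v″} → v″ ≡ v → ∀ e p e′ p′ →
        dart-value v′ v″ e′ p′ ≈ᵘ dart-value v v′ e p ⁻¹
      dart-value-reverse (inj₁ b) (inj₂ w) ≡.refl e p e′ p′ =
        Group.⁻¹-cong units {edge-value e′} {edge-value e} refl
      dart-value-reverse (inj₂ w) (inj₁ b) ≡.refl e p e′ p′ = refl

      dart-value-black : ∀ v v′ e p {b w} → v ≡ inj₁ b → v′ ≡ inj₂ w →
        proj₁ (dart-value v v′ e p) ≈ fun (forms w .proj₁) (vec (gens b))
      dart-value-black _ _ e p ≡.refl ≡.refl = refl

      edge-units : Dart → Unit
      edge-units x = dart-value (vertex x) (vertex (α x)) (edges-ok ρ x) (bipartite x)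

      framing : Framing ρ edge-units
      framing = record
        { form = λ w → forms w .proj₁
        ; gen = gens
        ; connection = λ x → dart-value-reverse _ _ (≡.cong vertex (α-invol x)) _ _ _ _
        ; value = λ x → dart-value-black _ _ _ _
        }

    holonomy⇒incidence : HolonomyTheorem → IncidenceTheorem R n T
    holonomy⇒incidence thm ρ f₀ coherent x x∈f₀ = tile⇔flat F x .from
      (thm (edge-units ρ) (Framing.connection F) f₀ (λ y y∉f₀ → tile⇔flat F y .to (coherent (face y) y∉f₀ y ≡.refl)) x x∈f₀)
      where
      F : Framing ρ (edge-units ρ)
      F = framing ρ

  -- Coordinate points, and hyperplanes given by coefficients.

  basis : Fin (suc n) → V
  basis i j with i ≟ j
  ... | yes _ = 1#
  ... | no _  = 0#

  basis-at : ∀ i → basis i i ≈ 1#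
  basis-at i with i ≟ i
  ... | yes _ = refl
  ... | no i≢i = contradiction ≡.refl i≢i

  line : Fin (suc n) → Sub
  line i = record
    { mem = λ v → ∃ λ r → v ≋ r ⊙ basis i
    ; mem-resp = λ { u≋v (r , eq) → r , λ j → trans (sym (u≋v j)) (eq j) }
    ; mem-0 = 0# , λ j → sym (zeroˡ _)
    ; mem-+ = λ { (r , eq) (s , eq′) → r + s , λ j → trans (+-cong (eq j) (eq′ j)) (sym (distribʳ _ _ _)) }
    ; mem-· = λ { t (r , eq) → t * r , λ j → trans (*-congˡ (eq j)) (sym (*-assoc _ _ _)) }
    }

  line-free : ∀ i → FreeRankOne R n (line i)
  line-free i = basis i , (λ v → mk⇔ id id) , λ r eq →
    trans (sym (*-identityʳ r)) (trans (*-congˡ (sym (basis-at i))) (eq i))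

  module _ (k : V) where

    -- Coefficients multiply from the right, which makes `dot` linear over left scalars.
    terms : V → Fin (suc n) → Carrier
    terms v i = v i * k i

    dot : V → Carrier
    dot v = sum (terms v)

    dot-cong : ∀ {u v} → u ≋ v → dot u ≈ dot v
    dot-cong {u} {v} eq = sum-cong-≋ {suc n} {terms u} {terms v} (λ i → *-congʳ (eq i))

    dot-+ : ∀ u v → dot (u ⊕ v) ≈ dot u + dot v
    dot-+ u v = trans
      (sum-cong-≋ {suc n} {terms (u ⊕ v)} (λ i → distribʳ (k i) (u i) (v i)))
      (∑-distrib-+ (terms u) (terms v))

    dot-· : ∀ r v → dot (r ⊙ v) ≈ r * dot v
    dot-· r v = trans
      (sum-cong-≋ {suc n} {terms (r ⊙ v)} (λ i → *-assoc r (v i) (k i)))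
      (sym (*-distribˡ-sum r (terms v)))

    orthogonal : Sub
    orthogonal = record
      { mem = λ v → Lift c (dot v ≈ 0#)
      ; mem-resp = λ { eq (lift p) → lift (trans (sym (dot-cong eq)) p) }
      ; mem-0 = lift (trans (trans (dot-cong (λ i → sym (zeroˡ 0#))) (dot-· 0# (0ᴹ R n))) (zeroˡ _))
      ; mem-+ = λ { {u} {v} (lift p) (lift q) →
          lift (trans (dot-+ u v) (trans (+-cong p q) (+-identityˡ 0#))) }
      ; mem-· = λ { r {v} (lift p) → lift (trans (dot-· r v) (trans (*-congˡ p) (zeroʳ r))) }
      }

    dot-form : Form orthogonal
    dot-form = record
      { fun = dot ; fun-cong = dot-cong ; fun-+ = dot-+ ; fun-· = dot-·
      ; kernel = λ v → mk⇔ lower lift }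

    dot-basis : ∀ i → dot (basis i) ≈ k i
    dot-basis i = begin
      dot (basis i)                                    ≈⟨ sum-remove {i = i} (terms (basis i)) ⟩
      basis i i * k i + sum (removeAt (terms (basis i)) i)
        ≈⟨ +-cong (trans (*-congʳ (basis-at i)) (*-identityˡ _))
             (trans (sum-cong-≋ off) (sum-replicate-zero n)) ⟩
      k i + 0#                                         ≈⟨ +-identityʳ _ ⟩
      k i                                              ∎
      where
      off : ∀ j → removeAt (terms (basis i)) i j ≈ 0#
      off j with i ≟ punchIn i j
      ... | yes eq = contradiction (≡.sym eq) (punchInᵢ≢i i j)
      ... | no _   = zeroˡ _

    line⊕orthogonal : ∀ i → IsUnit R (k i) → DirectSum R n (line i) orthogonal
    line⊕orthogonal i (w , kw , wk) = decompose , disjoint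
      where
      decompose : ∀ v → ∃₂ λ a b → mem (line i) a × mem orthogonal b × v ≋ a ⊕ b
      decompose v = r ⊙ basis i , 1# ⊙ v ⊕ (- r) ⊙ basis i , (r , λ j → refl) , lift (begin
          dot (1# ⊙ v ⊕ (- r) ⊙ basis i)   ≈⟨ fun-combine dot-form 1# v (- r) (basis i) (λ j → refl) ⟩
          1# * dot v + - r * dot (basis i)   ≈⟨ +-cong (*-identityˡ _) (*-congˡ (dot-basis i)) ⟩
          dot v + - r * k i                ≈⟨ +-congˡ (-‿distribˡ-* r (k i)) ⟨
          dot v - dot v * w * k i          ≈⟨ +-congˡ (-‿cong (trans (*-assoc _ _ _) (trans (*-congˡ wk) (*-identityʳ _)))) ⟩
          dot v - dot v                    ≈⟨ -‿inverseʳ _ ⟩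
          0#                               ∎) , λ j → begin
          v j                                                  ≈⟨ xyx⁻¹≈y (r * basis i j) (v j) ⟨
          r * basis i j + v j - r * basis i j                  ≈⟨ +-assoc _ _ _ ⟩
          r * basis i j + (v j - r * basis i j)                ≈⟨ +-congˡ (+-cong (sym (*-identityˡ _)) (-‿distribˡ-* _ _)) ⟩
          r * basis i j + (1# * v j + - r * basis i j)         ∎
        where
        r : Carrier
        -- Chosen so that `r * k i` is `dot v`: subtracting `r ⊙ basis i` moves `v` into the kernel.
        r = dot v * w
      disjoint : ∀ v → mem (line i) v → mem orthogonal v → v ≋ 0ᴹ R n
      disjoint v (r , eq) (lift v⊥k) j = trans (eq j) (trans (*-congʳ r≈0) (zeroˡ _))
        where
        r≈0 : r ≈ 0#
        r≈0 = begin
          r                       ≈⟨ *-identityʳ r ⟨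
          r * 1#                  ≈⟨ *-congˡ kw ⟨
          r * (k i * w)           ≈⟨ *-assoc _ _ _ ⟨
          r * k i * w             ≈⟨ *-congʳ (*-congˡ (dot-basis i)) ⟨
          r * dot (basis i) * w   ≈⟨ *-congʳ (dot-· r (basis i)) ⟨
          dot (r ⊙ basis i) * w   ≈⟨ *-congʳ (dot-cong eq) ⟨
          dot v * w               ≈⟨ *-congʳ v⊥k ⟩
          0# * w                  ≈⟨ zeroˡ w ⟩
          0#                      ∎

  line-point : ∀ i → IsPoint R n (line i)
  line-point i = line-free i , orthogonal (basis i) ,
    line⊕orthogonal (basis i) i (IsUnit-resp (sym (basis-at i)) (1# , *-identityˡ 1# , *-identityˡ 1#))

  -- Realizing a prescribed connection.

  module _ (T : QuadTiling) (bound : QuadTiling.nBlack T ∸ 1 ≤ n) where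
    open QuadTiling T
    open Tiling T
    open Holonomy units

    -- The bound on `n` leaves room for one basis vector per black vertex, so the values of a form
    -- at different black points can be prescribed independently.
    axis : Fin nBlack → Fin (suc n)
    axis = λ b → inject≤ b nBlack≤
      where
      nBlack≤ : nBlack ≤ suc n
      nBlack≤ = ℕ.≤-trans (ℕ.m≤n+m∸n nBlack 1) (ℕ.s≤s bound)

    axis-injective : ∀ {b b′} → axis b ≡ axis b′ → b ≡ b′
    axis-injective = inject≤-injective _ _ _ _

    module _ (h : Dart → Unit) (connection : Connection h) where

      Joins : Fin nWhite → Fin (suc n) → Dart → Set
      Joins w i x = vertex (α x) ≡ inj₂ w × ∃ λ b → vertex x ≡ inj₁ b × axis b ≡ i

      joins? : ∀ w i → Dec (∃ (Joins w i))
      joins? w i = any? λ x → (vertex (α x) ≟ᵛ inj₂ w) ×-dec any? λ b → (vertex x ≟ᵛ inj₁ b) ×-dec (axis b ≟ i)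
        where
        _≟ᵛ_ : (u v : Fin nBlack ⊎ Fin nWhite) → Dec (u ≡ v)
        _≟ᵛ_ = ≡-dec _≟_ _≟_

      coefficients : Fin nWhite → V
      coefficients w i with joins? w i
      ... | yes (x , _) = proj₁ (h x)
      -- No edge joins this basis vector to `w`, so the coefficient is arbitrary.
      ... | no _        = 0#

      -- The dart found by `joins?` has the same ends as `x` because `axis` is injective, and
      -- simplicity of the tiling then makes it equal to `x`.
      coefficients-at : ∀ x {b w} → vertex x ≡ inj₁ b → vertex (α x) ≡ inj₂ w →
        coefficients w (axis b) ≡ proj₁ (h x)
      coefficients-at x {b} {w} vx vαx with joins? w (axis b)
      ... | no ¬joins = contradiction (x , vαx , b , vx , ≡.refl) ¬joins
      ... | yes (y , vαy , b′ , vy , eq) = ≡.cong (proj₁ ∘ h) (simple y x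
              (≡.trans vy (≡.trans (≡.cong inj₁ (axis-injective eq)) (≡.sym vx)))
              (≡.trans vαy (≡.sym vαx)))

      nonneighboring : ∀ x {b w} → vertex x ≡ inj₁ b → vertex (α x) ≡ inj₂ w →
        NonNeighboring R n (line (axis b)) (orthogonal (coefficients w))
      nonneighboring x {b} {w} vx vαx = line⊕orthogonal (coefficients w) (axis b)
        (IsUnit-resp (reflexive (≡.sym (coefficients-at x vx vαx))) (proj₂ (h x)))

      black-opposite : ∀ x {w} → vertex x ≡ inj₂ w → ∃ λ b → vertex (α x) ≡ inj₁ b
      black-opposite x eq with black-after T x eq
      ... | b , eq′ = b , ≡.trans (≡.sym (vertex-σ (α x))) eq′

      edge-condition : ∀ x → EdgeCond R n (line ∘ axis) (orthogonal ∘ coefficients)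
                               (vertex x) (vertex (α x))
      edge-condition x with vertex x in vx | vertex (α x) in vαx
      ... | inj₁ b | inj₂ w = nonneighboring x vx vαx
      ... | inj₂ w | inj₁ b = nonneighboring (α x) vαx (≡.trans (≡.cong vertex (α-invol x)) vx)
      ... | inj₁ _ | inj₁ _ = tt
      ... | inj₂ _ | inj₂ _ = tt

      realization : Realization R n T
      realization = record
        { pt = line ∘ axis
        ; hp = orthogonal ∘ coefficients
        ; pt-point = line-point ∘ axis
        ; hp-hyperplane = λ w → let
            -- Every white vertex carries a dart, whose black end supplies the complementary point.
            (x , vx) = vertex-surj (inj₂ w)
            (b , vαx) = black-opposite x vx in
            line (axis b) , line-point (axis b) ,
            nonneighboring (α x) vαx (≡.trans (≡.cong vertex (α-invol x)) vx)
        ; edges-ok = edge-condition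
        }

      realization-framing : Framing T realization h
      realization-framing = record
        { form = dot-form ∘ coefficients
        ; gen = generator ∘ line-free ∘ axis
        ; connection = connection
        ; value = λ x {b} {w} vx vαx →
            trans (reflexive (≡.sym (coefficients-at x vx vαx))) (sym (dot-basis (coefficients w) (axis b)))
        }

    -- The connection is itself the system of edge values of its realization, so the same tiles are
    -- flat and coherent.
    incidence⇒holonomy : IncidenceTheorem R n T → HolonomyTheorem
    incidence⇒holonomy thm h conn f₀ flat x x∈f₀ = tile⇔flat T F x .to
      (thm (realization h conn) f₀
        (λ f f≢f₀ y y∈f → tile⇔flat T F y .from (flat y (λ y∈f₀ → f≢f₀ (≡.trans (≡.sym y∈f) y∈f₀)))) x x∈f₀)
      where
      F : Framing T (realization h conn) h
      F = realization-framing h conn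

theorem8p12 : ∀ {c ℓ} (T : QuadTiling) (R : Ring c ℓ) (n : ℕ) →
    QuadTiling.nBlack T ∸ 1 ≤ n →
    IncidenceTheorem R n T ⇔ UnitsCommutative R
theorem8p12 T R n bound = mk⇔
  (λ incidence u v u-unit v-unit →
    holonomy⇒commutative (incidence⇒holonomy T bound incidence) (u , u-unit) (v , v-unit))
  (λ comm → holonomy⇒incidence T (commutative⇒holonomy λ (u , u-unit) (v , v-unit) → comm u v u-unit v-unit))
  where
  open Projective R n
  open Tiling T
  open Holonomy (Units.units R)
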